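{- For every $k\geq3$, and for the patterns below whenever they are defined (the last three require $k\geq4$), each of the generating functions $$F_{1\mbox{ - }2\mbox{ - }\cdots\mbox{ - }(k-2)\mbox{ - }(k-1)k}(x),\quad F_{12\mbox{ - }3\mbox{ - }\cdots\mbox{ - }(k-2)\mbox{ - }(k-1)k}(x),\quad F_{2\mbox{ - }1\mbox{ - }3\mbox{ - }\cdots\mbox{ - }(k-2)\mbox{ - }(k-1)k}(x),\quad F_{21\mbox{ - }3\mbox{ - }\cdots\mbox{ - }(k-2)\mbox{ - }(k-1)k}(x)$$ equals $$\frac{1-x-\sqrt{1-2x+x^2-4x^2R_{k-2}(x)}}{2x^2R_{k-2}(x)}.$$
   Context: A generalized pattern is a permutation of $\{1,\dots,k\}$ written as a word $\tau_1\cdots\tau_k$ in which each pair of adjacent letters may or may not be separated by a dash "-". A permutation $\pi=\pi_1\cdots\pi_n\in S_n$ contains $\tau$ if there are indices $i_1<\dots<i_k$ with $(\pi_{i_1},\dots,\pi_{i_k})$ order-isomorphic to $(\tau_1,\dots,\tau_k)$ and $i_{j+1}=i_j+1$ whenever $\tau_j,\tau_{j+1}$ are not separated by a dash; otherwise $\pi$ avoids $\tau$. Thus $1\mbox{ - }3\mbox{ - }2$ is the classical pattern $132$. $F_\tau(x)=\sum_{n\geq0}f_\tau(n)x^n$, where $f_\tau(n)$ is the number of permutations in $S_n$ ($S_0$ = the empty permutation) avoiding both $1\mbox{ - }3\mbox{ - }2$ and $\tau$. $U_p(\cos\theta)=\sin((p+1)\theta)/\sin\theta$ is the Chebyshev polynomial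 of the second kind and $R_p(x)=\dfrac{U_{p-1}\left(\frac{1}{2\sqrt{x}}\right)}{\sqrt{x}\,U_p\left(\frac{1}{2\sqrt{x}}\right)}$. -}

module Defs where

open import Data.Bool using (Bool; true; false; _∧_; _∨_; not; if_then_else_)
open import Data.Nat as ℕ using (ℕ; zero; suc; _∸_; _≡ᵇ_; _<ᵇ_)
open import Data.List using (List; []; _∷_; _++_; length; map; concatMap; upTo; replicate; filterᵇ; zip)
open import Data.Bool.ListAction using (any; all)
open import Data.Product using (_×_; _,_; proj₁; proj₂)
open import Data.Integer using (+_)
open import Data.Rational using (ℚ; 0ℚ; 1ℚ; ½; _+_; _*_; _-_; -_; 1/_; ≢-nonZero)
open import Data.Rational.Properties using (_≟_)
open import Relation.Nullary using (yes; no)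

-- A permutation π ∈ S_n is represented as its one-line word π₁⋯πₙ,
-- a list of length n whose entries are 1..n, each exactly once.

words : ℕ → ℕ → List (List ℕ)
words zero    m = [] ∷ []
words (suc n) m = concatMap (λ a → map (a ∷_) (words n m)) (map suc (upTo m))

memberᵇ : ℕ → List ℕ → Bool
memberᵇ a []       = false
memberᵇ a (b ∷ bs) = (a ≡ᵇ b) ∨ memberᵇ a bs

distinctᵇ : List ℕ → Bool
distinctᵇ []       = true
distinctᵇ (a ∷ as) = not (memberᵇ a as) ∧ distinctᵇ as

S : ℕ → List (List ℕ)
S n = filterᵇ distinctᵇ (words n n)

-- A generalized pattern τ₁⋯τ_k: the word τ₁⋯τ_k (a permutation of 1..k)
-- and, for each j = 1..k-1, a flag which is true iff τ_j and τ_{j+1}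
-- are NOT separated by a dash (i.e. must be adjacent in an occurrence).
record GPattern : Set where
  constructor gpat
  field
    word : List ℕ
    adj  : List Bool
open GPattern public

subs : {A : Set} → ℕ → List A → List (List A)
subs zero    xs       = [] ∷ []
subs (suc k) []       = []
subs (suc k) (x ∷ xs) = map (x ∷_) (subs k xs) ++ subs (suc k) xs

indexed : List ℕ → List (ℕ × ℕ)
indexed π = zip (map suc (upTo (length π))) π

adjOK : List Bool → List (ℕ × ℕ) → Bool
adjOK (b ∷ bs) ((i , _) ∷ (j , v) ∷ rest) =
  (not b ∨ (j ≡ᵇ suc i)) ∧ adjOK bs ((j , v) ∷ rest)
adjOK _ _ = true

-- order-isomorphism of two words of distinct letters, given as list of pairs
-- (τ_j , π_{i_j}): for all j, l, τ_j < τ_l iff π_{i_j} < π_{i_l}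
orderIsoᵇ : List (ℕ × ℕ) → Bool
orderIsoᵇ ps =
  all (λ p → all (λ q → (proj₁ p <ᵇ proj₁ q) ≡ᵇᵇ (proj₂ p <ᵇ proj₂ q)) ps) ps
  where
  _≡ᵇᵇ_ : Bool → Bool → Bool
  true  ≡ᵇᵇ b = b
  false ≡ᵇᵇ b = not b

containsᵇ : List ℕ → GPattern → Bool
containsᵇ π τ =
  any (λ occ → adjOK (adj τ) occ ∧ orderIsoᵇ (zip (word τ) (map proj₂ occ)))
      (subs (length (word τ)) (indexed π))

avoidsᵇ : List ℕ → GPattern → Bool
avoidsᵇ π τ = not (containsᵇ π τ)

p1-3-2 : GPattern
p1-3-2 = gpat (1 ∷ 3 ∷ 2 ∷ []) (false ∷ false ∷ [])

f : GPattern → ℕ → ℕ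
f τ n = length (filterᵇ (λ π → avoidsᵇ π p1-3-2 ∧ avoidsᵇ π τ) (S n))

w12 : ℕ → List ℕ
w12 k = map suc (upTo k)

w21 : ℕ → List ℕ
w21 k = 2 ∷ 1 ∷ map (λ i → 3 ℕ.+ i) (upTo (k ∸ 2))

adjLast : ℕ → List Bool
adjLast k = replicate (k ∸ 2) false ++ (true ∷ [])

adjFirstLast : ℕ → List Bool
adjFirstLast k = true ∷ replicate (k ∸ 3) false ++ (true ∷ [])

pat1 : ℕ → GPattern
pat1 k = gpat (w12 k) (adjLast k)

pat2 : ℕ → GPattern
pat2 k = gpat (w12 k) (adjFirstLast k)

pat3 : ℕ → GPattern
pat3 k = gpat (w21 k) (adjLast k)

pat4 : ℕ → GPattern
pat4 k = gpat (w21 k) (adjFirstLast k)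

PS : Set
PS = ℕ → ℚ

sumR : ℕ → (ℕ → ℚ) → ℚ
sumR zero    g = 0ℚ
sumR (suc n) g = sumR n g + g n

at : List ℚ → ℕ → ℚ
at []       _       = 0ℚ
at (q ∷ qs) zero    = q
at (q ∷ qs) (suc n) = at qs n

fromℕℚ : ℕ → ℚ
fromℕℚ n = + n / 1
  where open import Data.Rational using (_/_)

constPS : ℚ → PS
constPS c zero    = c
constPS c (suc _) = 0ℚ

onePS : PS
onePS = constPS 1ℚ

X : PS
X (suc zero) = 1ℚ
X _          = 0ℚ

_⊕_ : PS → PS → PS
(a ⊕ b) n = a n + b n

_⊖_ : PS → PS → PS
(a ⊖ b) n = a n - b n

scale : ℚ → PS → PS
scale c a n = c * a n

_⊛_ : PS → PS → PS
(a ⊛ b) n = sumR (suc n) (λ i → a i * b (n ∸ i))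

-- reciprocal of a rational (only used on non-zero arguments)
recip : ℚ → ℚ
recip q with q ≟ 0ℚ
... | yes _  = 0ℚ
... | no q≢0 = 1/_ q {{≢-nonZero q≢0}}

-- coefficients b_0..b_n of 1/a (for a with a_0 ≠ 0):
-- b_0 = 1/a_0, b_m = -(1/a_0) Σ_{i=1}^{m} a_i b_{m-i}
invList : PS → ℕ → List ℚ
invList a zero    = recip (a 0) ∷ []
invList a (suc n) =
  let bs = invList a n in
  bs ++ ((- (recip (a 0) * sumR (suc n) (λ i → a (suc i) * at bs (n ∸ i)))) ∷ [])

inv : PS → PS
inv a n = at (invList a n) n

-- coefficients s_0..s_n of the square root √a with constant term 1
-- (for a with a_0 = 1): s_0 = 1, s_m = (a_m - Σ_{i=1}^{m-1} s_i s_{m-i}) / 2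
sqrtList : PS → ℕ → List ℚ
sqrtList a zero    = 1ℚ ∷ []
sqrtList a (suc n) =
  let ss = sqrtList a n in
  ss ++ (((a (suc n) - sumR n (λ i → at ss (suc i) * at ss (n ∸ i))) * ½) ∷ [])

sqrtPS : PS → PS
sqrtPS a n = at (sqrtList a n) n

-- division by x²  (for a series whose coefficients of x⁰, x¹ vanish)
divX² : PS → PS
divX² a n = a (suc (suc n))

-- V p = (√x)^p · U_p(1/(2√x)), a polynomial in x.  From U_0 = 1, U_1(t) = 2t,
-- U_{p+2}(t) = 2t U_{p+1}(t) - U_p(t) one gets
-- V 0 = 1, V 1 = 1, V (p+2) = V (p+1) - x · V p.
V : ℕ → PS
V zero             = onePS
V (suc zero)       = onePS
V (suc (suc p))    = V (suc p) ⊖ (X ⊛ V p)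

-- R_p(x) = U_{p-1}(1/(2√x)) / (√x U_p(1/(2√x))) = V (p-1) / V p   (p ≥ 1)
R : ℕ → PS
R p = V (p ∸ 1) ⊛ inv (V p)

G : ℕ → PS
G k =
  let r   = R (k ∸ 2)
      x²  = X ⊛ X
      Δ   = ((onePS ⊖ scale (fromℕℚ 2) X) ⊕ x²) ⊖ scale (fromℕℚ 4) (x² ⊛ r)
      num = (onePS ⊖ X) ⊖ sqrtPS Δ
  in divX² num ⊛ inv (scale (fromℕℚ 2) r)

-- A 132-avoiding permutation is empty or L m R with m its maximum, every letter of L exceeding every letter
-- of R, and L and R again 132-avoiding: these permutations are the binary trees.  Along this decomposition a
-- permutation avoids τ-(p+1) iff L avoids τ and R avoids τ-(p+1), so F_{τ-(p+1)} = 1 / (1 - x F_τ).  This is the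
-- recurrence of R_p, and it starts with the patterns 1, 12, 21, 2-1, whose series are R_1 and R_2.
--
-- For τ′ = τ-(p+1)(p+2) an ascent at the junction "last letter of L, m" must be watched: L m R avoids τ′ iff R
-- and the word L m do.  Writing H for the series of those L for which L m avoids τ′, one gets F = 1 + x H F, and
-- the same decomposition of L gives H = 1 + N with N = x F_τ + x H N.  Eliminating H and N,
-- F = 1 + x F + x² F_τ F², and completing the square shows that the stated closed form is the only solution.

module Submission where

open import Defs
open import Data.Nat using (ℕ; _≤_)
open import Data.Product using (_×_)
open import Relation.Binary.PropositionalEquality using (_≡_)

-- An occurrence of these patterns can be read from its end, because each appended pattern letter
-- exceeds all earlier ones. If its last letter, or the lower letter of its final ascent, lies in R,
-- all earlier letters are smaller still and lie in R too. The maximum m and the first letter of R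
-- form a descent, so a final ascent lies in L m or in R. In the equation for N a larger letter b
-- follows L m R, and now emptiness of R matters: if R is empty, m b is an ascent and L must avoid τ
-- (the term x F_τ); otherwise L m and R b are tested separately (the term x H N).
--
-- The statement counts lists by Boolean tests on positions and order isomorphism. Between these and
-- the trees stands the relation `Occurs`, which carries an upper bound for the letters used. That
-- one number replaces order isomorphism, since a new largest letter only has to exceed it. The
-- series are kept cross-multiplied, as F V_p = V_(p-1), so that the recurrence of R_p is polynomial
-- algebra; division and the square root enter only at the end.

module PowerSeries where

  open import Data.Integer as ℤ using ()
  import Data.Integer.Properties as ℤₚ
  open import Data.Rational.Unnormalised using (mkℚᵘ; *≡*)
  import Data.Rational.Unnormalised.Properties as ℚᵘₚ
  open import Data.Nat as ℕ using (ℕ; zero; suc; _∸_)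
  open import Data.Rational using (ℚ; 0ℚ; 1ℚ; ½; _+_; _*_; _-_; -_; ≢-nonZero)
  import Data.Rational.Properties as ℚₚ
  open import Data.Rational.Solver using (module +-*-Solver)
  open import Data.Product using (_,_)
  open import Data.Maybe using (Maybe; just; nothing)
  open import Data.List using (List; []; _∷_; _++_; length)
  open import Data.List.Properties using (length-++)
  import Data.Nat.Properties as ℕₚ
  open import Function using (_∘_)
  open import Level using (0ℓ)
  open import Relation.Nullary using (yes; no; contradiction)
  open import Relation.Binary.PropositionalEquality hiding (setoid)
  open import Algebra.Bundles using (CommutativeRing; RawRing)
  import Algebra.Solver.Ring.AlmostCommutativeRing as ACR
  import Algebra.Solver.Ring as RingSolver
  open +-*-Solver using (solve; _:=_; _:+_; _:*_; _:-_; :-_; con)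
  open ≡-Reasoning

  -- The ring of formal power series over ℚ

  sumR-cong : ∀ n {g h : ℕ → ℚ} → g ≗ h → sumR n g ≡ sumR n h
  sumR-cong zero    g≗h = refl
  sumR-cong (suc n) g≗h = cong₂ _+_ (sumR-cong n g≗h) (g≗h n)

  sumR-suc : ∀ n g → sumR (suc n) g ≡ g 0 + sumR n (g ∘ suc)
  sumR-suc zero    g = ℚₚ.+-comm 0ℚ (g 0)
  sumR-suc (suc n) g = begin
    sumR (suc n) g + g (suc n)                  ≡⟨ cong (_+ g (suc n)) (sumR-suc n g) ⟩
    (g 0 + sumR n (g ∘ suc)) + g (suc n)        ≡⟨ ℚₚ.+-assoc (g 0) _ _ ⟩
    g 0 + (sumR n (g ∘ suc) + g (suc n))        ∎

  shift : PS → PS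
  shift a n = a (suc n)

  zeroPS : PS
  zeroPS _ = 0ℚ

  neg : PS → PS
  neg a n = - a n

  ⊛-zero : ∀ a b → (a ⊛ b) 0 ≡ a 0 * b 0
  ⊛-zero a b = ℚₚ.+-identityˡ (a 0 * b 0)

  -- Peeling one term off the Cauchy sum leaves a product with a shifted left factor. The ring laws
  -- then follow by induction on the coefficient index, without rearranging double sums.
  ⊛-suc : ∀ a b n → (a ⊛ b) (suc n) ≡ a 0 * b (suc n) + (shift a ⊛ b) n
  ⊛-suc a b n = sumR-suc (suc n) (λ i → a i * b (suc n ∸ i))

  ⊛-cong : ∀ {a a′ b b′} → a ≗ a′ → b ≗ b′ → (a ⊛ b) ≗ (a′ ⊛ b′)
  ⊛-cong p q n = sumR-cong (suc n) (λ i → cong₂ _*_ (p i) (q (n ∸ i)))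

  -- The mirror image of `⊛-suc`, obtained by peeling from both ends; the two together make
  -- commutativity an induction.
  ⊛-sucʳ : ∀ a b n → (a ⊛ b) (suc n) ≡ a (suc n) * b 0 + (a ⊛ shift b) n
  ⊛-sucʳ a b zero = begin
    (a ⊛ b) 1                          ≡⟨ ⊛-suc a b 0 ⟩
    a 0 * b 1 + (shift a ⊛ b) 0        ≡⟨ cong (a 0 * b 1 +_) (⊛-zero (shift a) b) ⟩
    a 0 * b 1 + a 1 * b 0              ≡⟨ ℚₚ.+-comm (a 0 * b 1) (a 1 * b 0) ⟩
    a 1 * b 0 + a 0 * b 1              ≡⟨ cong (a 1 * b 0 +_) (⊛-zero a (shift b)) ⟨
    a 1 * b 0 + (a ⊛ shift b) 0        ∎
  ⊛-sucʳ a b (suc n) = begin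
    (a ⊛ b) (suc (suc n))
      ≡⟨ ⊛-suc a b (suc n) ⟩
    a 0 * b (suc (suc n)) + (shift a ⊛ b) (suc n)
      ≡⟨ cong (a 0 * b (suc (suc n)) +_) (⊛-sucʳ (shift a) b n) ⟩
    a 0 * b (suc (suc n)) + (a (suc (suc n)) * b 0 + (shift a ⊛ shift b) n)
      ≡⟨ solve 3 (λ x y z → x :+ (y :+ z) := y :+ (x :+ z)) refl (a 0 * b (suc (suc n))) (a (suc (suc n)) * b 0) ((shift a ⊛ shift b) n) ⟩
    a (suc (suc n)) * b 0 + (a 0 * b (suc (suc n)) + (shift a ⊛ shift b) n)
      ≡⟨ cong (a (suc (suc n)) * b 0 +_) (⊛-suc a (shift b) n) ⟨
    a (suc (suc n)) * b 0 + (a ⊛ shift b) (suc n) ∎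

  ⊛-comm : ∀ a b → (a ⊛ b) ≗ (b ⊛ a)
  ⊛-comm a b zero = begin
    (a ⊛ b) 0    ≡⟨ ⊛-zero a b ⟩
    a 0 * b 0    ≡⟨ ℚₚ.*-comm (a 0) (b 0) ⟩
    b 0 * a 0    ≡⟨ ⊛-zero b a ⟨
    (b ⊛ a) 0    ∎
  ⊛-comm a b (suc n) = begin
    (a ⊛ b) (suc n)                      ≡⟨ ⊛-suc a b n ⟩
    a 0 * b (suc n) + (shift a ⊛ b) n    ≡⟨ cong₂ _+_ (ℚₚ.*-comm (a 0) (b (suc n))) (⊛-comm (shift a) b n) ⟩
    b (suc n) * a 0 + (b ⊛ shift a) n    ≡⟨ ⊛-sucʳ b a n ⟨
    (b ⊛ a) (suc n)                      ∎

  ⊛-distribʳ : ∀ c a b → ((a ⊕ b) ⊛ c) ≗ ((a ⊛ c) ⊕ (b ⊛ c))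
  ⊛-distribʳ c a b zero = begin
    ((a ⊕ b) ⊛ c) 0              ≡⟨ ⊛-zero (a ⊕ b) c ⟩
    (a 0 + b 0) * c 0            ≡⟨ ℚₚ.*-distribʳ-+ (c 0) (a 0) (b 0) ⟩
    a 0 * c 0 + b 0 * c 0        ≡⟨ cong₂ _+_ (⊛-zero a c) (⊛-zero b c) ⟨
    (a ⊛ c) 0 + (b ⊛ c) 0        ∎
  ⊛-distribʳ c a b (suc n) = begin
    ((a ⊕ b) ⊛ c) (suc n)
      ≡⟨ ⊛-suc (a ⊕ b) c n ⟩
    (a 0 + b 0) * c (suc n) + ((shift a ⊕ shift b) ⊛ c) n
      ≡⟨ cong ((a 0 + b 0) * c (suc n) +_) (⊛-distribʳ c (shift a) (shift b) n) ⟩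
    (a 0 + b 0) * c (suc n) + ((shift a ⊛ c) n + (shift b ⊛ c) n)
      ≡⟨ solve 5 (λ x y z u v → (x :+ y) :* z :+ (u :+ v) := (x :* z :+ u) :+ (y :* z :+ v)) refl
           (a 0) (b 0) (c (suc n)) ((shift a ⊛ c) n) ((shift b ⊛ c) n) ⟩
    (a 0 * c (suc n) + (shift a ⊛ c) n) + (b 0 * c (suc n) + (shift b ⊛ c) n)
      ≡⟨ cong₂ _+_ (⊛-suc a c n) (⊛-suc b c n) ⟨
    (a ⊛ c) (suc n) + (b ⊛ c) (suc n) ∎

  -- Used for associativity: by `⊛-suc` the shift of `a ⊛ b` contains the scalar multiple
  -- `scale (a 0) (shift b)`.
  scale-⊛ : ∀ q a b → (scale q a ⊛ b) ≗ scale q (a ⊛ b)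
  scale-⊛ q a b zero = begin
    (scale q a ⊛ b) 0   ≡⟨ ⊛-zero (scale q a) b ⟩
    q * a 0 * b 0       ≡⟨ ℚₚ.*-assoc q (a 0) (b 0) ⟩
    q * (a 0 * b 0)     ≡⟨ cong (q *_) (⊛-zero a b) ⟨
    q * (a ⊛ b) 0       ∎
  scale-⊛ q a b (suc n) = begin
    (scale q a ⊛ b) (suc n)                          ≡⟨ ⊛-suc (scale q a) b n ⟩
    q * a 0 * b (suc n) + (scale q (shift a) ⊛ b) n  ≡⟨ cong₂ _+_ (ℚₚ.*-assoc q (a 0) _) (scale-⊛ q (shift a) b n) ⟩
    q * (a 0 * b (suc n)) + q * (shift a ⊛ b) n      ≡⟨ ℚₚ.*-distribˡ-+ q _ _ ⟨
    q * (a 0 * b (suc n) + (shift a ⊛ b) n)          ≡⟨ cong (q *_) (⊛-suc a b n) ⟨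
    q * (a ⊛ b) (suc n)                              ∎

  ⊛-assoc : ∀ a b c → ((a ⊛ b) ⊛ c) ≗ (a ⊛ (b ⊛ c))
  ⊛-assoc a b c zero = begin
    ((a ⊛ b) ⊛ c) 0       ≡⟨ ⊛-zero (a ⊛ b) c ⟩
    (a ⊛ b) 0 * c 0       ≡⟨ cong (_* c 0) (⊛-zero a b) ⟩
    a 0 * b 0 * c 0       ≡⟨ ℚₚ.*-assoc (a 0) (b 0) (c 0) ⟩
    a 0 * (b 0 * c 0)     ≡⟨ cong (a 0 *_) (⊛-zero b c) ⟨
    a 0 * (b ⊛ c) 0       ≡⟨ ⊛-zero a (b ⊛ c) ⟨
    (a ⊛ (b ⊛ c)) 0       ∎
  ⊛-assoc a b c (suc n) = begin
    ((a ⊛ b) ⊛ c) (suc n)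
      ≡⟨ ⊛-suc (a ⊛ b) c n ⟩
    (a ⊛ b) 0 * c (suc n) + (shift (a ⊛ b) ⊛ c) n
      ≡⟨ cong₂ _+_ (cong (_* c (suc n)) (⊛-zero a b)) (⊛-cong {b = c} (⊛-suc a b) (λ _ → refl) n) ⟩
    a 0 * b 0 * c (suc n) + ((scale (a 0) (shift b) ⊕ (shift a ⊛ b)) ⊛ c) n
      ≡⟨ cong (a 0 * b 0 * c (suc n) +_) (⊛-distribʳ c (scale (a 0) (shift b)) (shift a ⊛ b) n) ⟩
    a 0 * b 0 * c (suc n) + ((scale (a 0) (shift b) ⊛ c) n + ((shift a ⊛ b) ⊛ c) n)
      ≡⟨ cong (a 0 * b 0 * c (suc n) +_) (cong₂ _+_ (scale-⊛ (a 0) (shift b) c n) (⊛-assoc (shift a) b c n)) ⟩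
    a 0 * b 0 * c (suc n) + (a 0 * (shift b ⊛ c) n + (shift a ⊛ (b ⊛ c)) n)
      ≡⟨ solve 5 (λ x y z u v → x :* y :* z :+ (x :* u :+ v) := x :* (y :* z :+ u) :+ v) refl
           (a 0) (b 0) (c (suc n)) ((shift b ⊛ c) n) ((shift a ⊛ (b ⊛ c)) n) ⟩
    a 0 * (b 0 * c (suc n) + (shift b ⊛ c) n) + (shift a ⊛ (b ⊛ c)) n
      ≡⟨ cong (λ z → a 0 * z + (shift a ⊛ (b ⊛ c)) n) (⊛-suc b c n) ⟨
    a 0 * (b ⊛ c) (suc n) + (shift a ⊛ (b ⊛ c)) n
      ≡⟨ ⊛-suc a (b ⊛ c) n ⟨
    (a ⊛ (b ⊛ c)) (suc n) ∎

  zeroPS-⊛ : ∀ a → (zeroPS ⊛ a) ≗ zeroPS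
  zeroPS-⊛ a zero    = trans (⊛-zero zeroPS a) (ℚₚ.*-zeroˡ (a 0))
  zeroPS-⊛ a (suc n) = trans (⊛-suc zeroPS a n) (cong₂ _+_ (ℚₚ.*-zeroˡ (a (suc n))) (zeroPS-⊛ a n))

  constPS-⊛ : ∀ q a → (constPS q ⊛ a) ≗ scale q a
  constPS-⊛ q a zero    = ⊛-zero (constPS q) a
  constPS-⊛ q a (suc n) = begin
    (constPS q ⊛ a) (suc n)            ≡⟨ ⊛-suc (constPS q) a n ⟩
    q * a (suc n) + (zeroPS ⊛ a) n     ≡⟨ cong (q * a (suc n) +_) (zeroPS-⊛ a n) ⟩
    q * a (suc n) + 0ℚ                 ≡⟨ ℚₚ.+-identityʳ _ ⟩
    q * a (suc n)                      ∎

  onePS-⊛ : ∀ a → (onePS ⊛ a) ≗ a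
  onePS-⊛ a n = trans (constPS-⊛ 1ℚ a n) (ℚₚ.*-identityˡ (a n))

  X-⊛-suc : ∀ a n → (X ⊛ a) (suc n) ≡ a n
  X-⊛-suc a n = begin
    (X ⊛ a) (suc n)                       ≡⟨ ⊛-suc X a n ⟩
    0ℚ * a (suc n) + (shift X ⊛ a) n      ≡⟨ cong₂ _+_ (ℚₚ.*-zeroˡ (a (suc n))) (⊛-cong {b = a} shift-X (λ _ → refl) n) ⟩
    0ℚ + (onePS ⊛ a) n                    ≡⟨ ℚₚ.+-identityˡ _ ⟩
    (onePS ⊛ a) n                         ≡⟨ onePS-⊛ a n ⟩
    a n                                   ∎
    where
    shift-X : shift X ≗ onePS
    shift-X zero    = refl
    shift-X (suc _) = refl

  X-⊛-zero : ∀ a → (X ⊛ a) 0 ≡ 0ℚ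
  X-⊛-zero a = trans (⊛-zero X a) (ℚₚ.*-zeroˡ (a 0))

  commutativeRing : CommutativeRing 0ℓ 0ℓ
  commutativeRing = record
    { Carrier = PS
    ; _≈_ = _≗_
    ; _+_ = _⊕_
    ; _*_ = _⊛_
    ; -_ = neg
    ; 0# = zeroPS
    ; 1# = onePS
    ; isCommutativeRing = record
      { isRing = record
        { +-isAbelianGroup = record
          { isGroup = record
            { isMonoid = record
              { isSemigroup = record
                { isMagma = record
                  { isEquivalence = record
                    { refl = λ _ → refl ; sym = λ p n → sym (p n) ; trans = λ p q n → trans (p n) (q n) }
                  ; ∙-cong = λ p q n → cong₂ _+_ (p n) (q n) }
                ; assoc = λ a b c n → ℚₚ.+-assoc (a n) (b n) (c n) }
              ; identity = (λ a n → ℚₚ.+-identityˡ (a n)) , (λ a n → ℚₚ.+-identityʳ (a n)) }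
            ; inverse = (λ a n → ℚₚ.+-inverseˡ (a n)) , (λ a n → ℚₚ.+-inverseʳ (a n))
            ; ⁻¹-cong = λ p n → cong -_ (p n) }
          ; comm = λ a b n → ℚₚ.+-comm (a n) (b n) }
        ; *-cong = ⊛-cong
        ; *-assoc = ⊛-assoc
        ; *-identity = onePS-⊛ , (λ a n → trans (⊛-comm a onePS n) (onePS-⊛ a n))
        ; distrib = (λ c a b n → trans (⊛-comm c (a ⊕ b) n) (trans (⊛-distribʳ c a b n)
                      (cong₂ _+_ (⊛-comm a c n) (⊛-comm b c n)))) , ⊛-distribʳ }
      ; *-comm = ⊛-comm } }

  private
    ℚ-rawRing : RawRing 0ℓ 0ℓ
    ℚ-rawRing = CommutativeRing.rawRing ℚₚ.+-*-commutativeRing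

    PS-acr : ACR.AlmostCommutativeRing 0ℓ 0ℓ
    PS-acr = ACR.fromCommutativeRing commutativeRing

    -- The solver takes its coefficients from ℚ, so that the constants 2 and 4 of the discriminant
    -- are evaluated by computation.
    constPS-homo : ℚ-rawRing ACR.-Raw-AlmostCommutative⟶ PS-acr
    constPS-homo = record
      { ⟦_⟧ = constPS
      ; +-homo = λ { p q zero → refl ; p q (suc n) → refl }
      ; *-homo = λ { p q zero → sym (constPS-⊛ p (constPS q) 0)
                   ; p q (suc n) → sym (trans (constPS-⊛ p (constPS q) (suc n)) (ℚₚ.*-zeroʳ p)) }
      ; -‿homo = λ { p zero → refl ; p (suc n) → refl }
      ; 0-homo = λ { zero → refl ; (suc n) → refl }
      ; 1-homo = λ _ → refl
      }

    const≟ : ∀ p q → Maybe (constPS p ≗ constPS q)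
    const≟ p q with p ℚₚ.≟ q
    ... | yes refl = just (λ _ → refl)
    ... | no _     = nothing

  module PS-Solver = RingSolver ℚ-rawRing PS-acr constPS-homo const≟

  open PS-Solver using () renaming (solve to psolve; _:=_ to _:≗_; _:+_ to _:⊕_; _:*_ to _:⊛_; _:-_ to _:⊖_; con to :con)


  -- Reciprocals and square roots of series

  *-recipʳ : ∀ q → q ≢ 0ℚ → q * recip q ≡ 1ℚ
  *-recipʳ q q≢0 with q ℚₚ.≟ 0ℚ
  ... | yes q≡0  = contradiction q≡0 q≢0
  ... | no  q≢0′ = ℚₚ.*-inverseʳ q {{≢-nonZero q≢0′}}

  at-++ˡ : ∀ xs {ys i} → i ℕ.< length xs → at (xs ++ ys) i ≡ at xs i
  at-++ˡ (x ∷ xs) {i = zero}  _           = refl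
  at-++ˡ (x ∷ xs) {i = suc i} (ℕ.s≤s i<n) = at-++ˡ xs i<n

  at-length : ∀ xs q → at (xs ++ (q ∷ [])) (length xs) ≡ q
  at-length []       q = refl
  at-length (x ∷ xs) q = at-length xs q

  -- Common to `invList` and `sqrtList`: a list of coefficients that grows by one entry `g n` per
  -- step. An entry never changes once appended, so reading it from a longer list gives the diagonal
  -- value that defines `inv` and `sqrtPS`.
  module Prefixes (L : ℕ → List ℚ) (g : ℕ → ℚ) (length-L0 : length (L 0) ≡ 1)
                  (L-suc : ∀ n → L (suc n) ≡ L n ++ (g n ∷ [])) where

    length-L : ∀ n → length (L n) ≡ suc n
    length-L zero    = length-L0
    length-L (suc n) = begin
      length (L (suc n))             ≡⟨ cong length (L-suc n) ⟩
      length (L n ++ (g n ∷ []))     ≡⟨ length-++ (L n) ⟩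
      length (L n) ℕ.+ 1             ≡⟨ ℕₚ.+-comm (length (L n)) 1 ⟩
      suc (length (L n))             ≡⟨ cong suc (length-L n) ⟩
      suc (suc n)                    ∎

    at-top : ∀ n → at (L (suc n)) (suc n) ≡ g n
    at-top n = begin
      at (L (suc n)) (suc n)                        ≡⟨ cong₂ at (L-suc n) (sym (length-L n)) ⟩
      at (L n ++ (g n ∷ [])) (length (L n))         ≡⟨ at-length (L n) (g n) ⟩
      g n                                           ∎

    at-stable : ∀ {n i} → i ℕ.≤ n → at (L n) i ≡ at (L i) i
    at-stable i≤n = go (ℕₚ.≤⇒≤′ i≤n)
      where
      go : ∀ {n i} → i ℕ.≤′ n → at (L n) i ≡ at (L i) i
      go ℕ.≤′-refl               = refl
      go {suc n} {i} (ℕ.≤′-step i≤n) = begin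
        at (L (suc n)) i              ≡⟨ cong (λ l → at l i) (L-suc n) ⟩
        at (L n ++ (g n ∷ [])) i      ≡⟨ at-++ˡ (L n) (subst (i ℕ.<_) (sym (length-L n)) (ℕ.s≤s (ℕₚ.≤′⇒≤ i≤n))) ⟩
        at (L n) i                    ≡⟨ go i≤n ⟩
        at (L i) i                    ∎

  ⊛-inv : ∀ a → a 0 ≢ 0ℚ → (a ⊛ inv a) ≗ onePS
  ⊛-inv a a₀≢0 zero    = trans (⊛-zero a (inv a)) (*-recipʳ (a 0) a₀≢0)
  ⊛-inv a a₀≢0 (suc n) = begin
    (a ⊛ inv a) (suc n)                                ≡⟨ ⊛-suc a (inv a) n ⟩
    a 0 * inv a (suc n) + s                            ≡⟨ cong (λ z → a 0 * z + s) (trans (P.at-top n) (cong (λ z → - (recip (a 0) * z)) step)) ⟩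
    a 0 * - (recip (a 0) * s) + s                      ≡⟨ solve 3 (λ x y z → x :* (:- (y :* z)) :+ z := (con 1ℚ :- x :* y) :* z) refl (a 0) (recip (a 0)) s ⟩
    (1ℚ - a 0 * recip (a 0)) * s                       ≡⟨ cong (λ z → (1ℚ - z) * s) (*-recipʳ (a 0) a₀≢0) ⟩
    0ℚ * s                                             ≡⟨ ℚₚ.*-zeroˡ s ⟩
    0ℚ                                                 ∎
    where
    s = (shift a ⊛ inv a) n
    module P = Prefixes (invList a) _ refl (λ _ → refl)
    step : sumR (suc n) (λ i → a (suc i) * at (invList a n) (n ∸ i)) ≡ s
    step = sumR-cong (suc n) (λ i → cong (a (suc i) *_) (P.at-stable (ℕₚ.m∸n≤m n i)))

  sumR-cong-< : ∀ n {g h : ℕ → ℚ} → (∀ {i} → i ℕ.< n → g i ≡ h i) → sumR n g ≡ sumR n h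
  sumR-cong-< zero    g≗h = refl
  sumR-cong-< (suc n) g≗h = cong₂ _+_ (sumR-cong-< n (λ i<n → g≗h (ℕₚ.m<n⇒m<1+n i<n))) (g≗h (ℕₚ.n<1+n n))

  -- The coefficient of index i + 1 in b² is twice that of b plus a sum over smaller indices.
  -- Solving for it gives the recursion of `sqrtList`; the constant term 1 selects the sign. All
  -- earlier coefficients are needed, hence the induction over a bound `m`.
  sqrtPS-unique : ∀ a b → b 0 ≡ 1ℚ → (b ⊛ b) ≗ a → sqrtPS a ≗ b
  sqrtPS-unique a b b₀≡1 b²≗a n = go n ℕₚ.≤-refl
    where
    module P = Prefixes (sqrtList a) _ refl (λ _ → refl)
    go : ∀ m {i} → i ℕ.≤ m → sqrtPS a i ≡ b i
    go zero    {zero}  _ = sym b₀≡1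
    go (suc m) {zero}  _ = sym b₀≡1
    go (suc m) {suc i} (ℕ.s≤s i≤m) = begin
      sqrtPS a (suc i)                                        ≡⟨ P.at-top i ⟩
      (a (suc i) - sumR i (λ j → at ss (suc j) * at ss (i ∸ j))) * ½
                                                              ≡⟨ cong₂ (λ y z → (y - z) * ½) (sym (b²≗a (suc i))) (sumR-cong-< i step) ⟩
      -- Both extreme terms of the Cauchy sum are split off: the lower by `⊛-suc`, the upper because
      -- `sumR` unfolds at its upper end.
      ((b ⊛ b) (suc i) - t) * ½                               ≡⟨ cong (λ z → (z - t) * ½) (⊛-suc b b i) ⟩
      (b 0 * b (suc i) + (t + b (suc i) * b (i ∸ i)) - t) * ½ ≡⟨ cong₂ (λ y z → (y * b (suc i) + (t + b (suc i) * z) - t) * ½) b₀≡1 (trans (cong b (ℕₚ.n∸n≡0 i)) b₀≡1) ⟩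
      (1ℚ * b (suc i) + (t + b (suc i) * 1ℚ) - t) * ½         ≡⟨ solve 2 (λ y z → (con 1ℚ :* y :+ (z :+ y :* con 1ℚ) :- z) :* con ½ := y) refl (b (suc i)) t ⟩
      b (suc i)                                               ∎
      where
      ss = sqrtList a i
      t  = sumR i (λ j → b (suc j) * b (i ∸ j))
      step : ∀ {j} → j ℕ.< i → at ss (suc j) * at ss (i ∸ j) ≡ b (suc j) * b (i ∸ j)
      step {j} j<i = cong₂ _*_ (trans (P.at-stable j<i) (go m (ℕₚ.≤-trans j<i i≤m)))
                               (trans (P.at-stable (ℕₚ.m∸n≤m i j)) (go m (ℕₚ.≤-trans (ℕₚ.m∸n≤m i j) i≤m)))

  -- `fromℕℚ` normalises by a gcd that does not compute for a variable; the identity is therefore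
  -- checked on unnormalised fractions.
  fromℕℚ-+ : ∀ m n → fromℕℚ (m ℕ.+ n) ≡ fromℕℚ m + fromℕℚ n
  fromℕℚ-+ m n = ℚₚ.toℚᵘ-injective (ℚᵘₚ.≃-trans (ℚₚ.toℚᵘ-fromℚᵘ (mkℚᵘ (ℤ.+ (m ℕ.+ n)) 0))
    (ℚᵘₚ.≃-trans (*≡* (cong (ℤ._* ℤ.+ 1) (cong₂ ℤ._+_ (sym (ℤₚ.*-identityʳ (ℤ.+ m))) (sym (ℤₚ.*-identityʳ (ℤ.+ n))))))
    (ℚᵘₚ.≃-sym (ℚᵘₚ.≃-trans (ℚₚ.toℚᵘ-homo-+ (fromℕℚ m) (fromℕℚ n))
      (ℚᵘₚ.+-cong (ℚₚ.toℚᵘ-fromℚᵘ (mkℚᵘ (ℤ.+ m) 0)) (ℚₚ.toℚᵘ-fromℚᵘ (mkℚᵘ (ℤ.+ n) 0)))))))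

  fromℕℚ-* : ∀ m n → fromℕℚ (m ℕ.* n) ≡ fromℕℚ m * fromℕℚ n
  fromℕℚ-* m n = ℚₚ.toℚᵘ-injective (ℚᵘₚ.≃-trans (ℚₚ.toℚᵘ-fromℚᵘ (mkℚᵘ (ℤ.+ (m ℕ.* n)) 0))
    (ℚᵘₚ.≃-trans (*≡* (cong (ℤ._* ℤ.+ 1) (ℤₚ.pos-* m n)))
    (ℚᵘₚ.≃-sym (ℚᵘₚ.≃-trans (ℚₚ.toℚᵘ-homo-* (fromℕℚ m) (fromℕℚ n))
      (ℚᵘₚ.*-cong (ℚₚ.toℚᵘ-fromℚᵘ (mkℚᵘ (ℤ.+ m) 0)) (ℚₚ.toℚᵘ-fromℚᵘ (mkℚᵘ (ℤ.+ n) 0)))))))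

  -- The recurrence of R and the solution of the quadratic equation

  open CommutativeRing commutativeRing using (setoid; +-cong; *-cong; +-congˡ; +-congʳ; *-congˡ; *-congʳ; *-identityˡ; *-identityʳ; +-identityʳ; zeroʳ)
    renaming (refl to ≗-refl; sym to ≗-sym; trans to ≗-trans)
  open import Relation.Binary.Reasoning.Setoid setoid as ≗-Reasoning using (step-≈-⟩; step-≈-⟨)
    renaming (begin_ to begin≗_; _∎ to _∎≗)

  ⊖-cong : ∀ {a a′ b b′} → a ≗ a′ → b ≗ b′ → (a ⊖ b) ≗ (a′ ⊖ b′)
  ⊖-cong p q n = cong₂ _-_ (p n) (q n)

  x≗y⊕z⇒x⊖z≗y : ∀ a b c → a ≗ (b ⊕ c) → (a ⊖ c) ≗ b
  x≗y⊕z⇒x⊖z≗y a b c p n = trans (cong (_- c n) (p n)) (solve 2 (λ y z → (y :+ z) :- z := y) refl (b n) (c n))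

  ⊛≗⇒≗⊛-inv : ∀ v a b → v 0 ≡ 1ℚ → (a ⊛ v) ≗ b → a ≗ (b ⊛ inv v)
  ⊛≗⇒≗⊛-inv v a b v₀≡1 av≗b = begin≗
    a                    ≈⟨ *-identityʳ a ⟨
    a ⊛ onePS            ≈⟨ *-congˡ {x = a} (⊛-inv v v₀≢0) ⟨
    a ⊛ (v ⊛ inv v)      ≈⟨ ⊛-assoc a v (inv v) ⟨
    (a ⊛ v) ⊛ inv v      ≈⟨ *-congʳ {x = inv v} av≗b ⟩
    b ⊛ inv v            ∎≗
    where
    v₀≢0 : v 0 ≢ 0ℚ
    v₀≢0 eq with () ← trans (sym v₀≡1) eq

  V-zero : ∀ p → V p 0 ≡ 1ℚ
  V-zero zero          = refl
  V-zero (suc zero)    = refl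
  V-zero (suc (suc p)) = cong₂ _-_ (V-zero (suc p)) (X-⊛-zero (V p))

  R-unique : ∀ p a → (a ⊛ V p) ≗ V (p ∸ 1) → a ≗ R p
  R-unique p a = ⊛≗⇒≗⊛-inv (V p) a (V (p ∸ 1)) (V-zero p)

  -- With a = R (p + 1), the equation for b says b = 1 / (1 - x a), which is the recurrence of R.
  V-step : ∀ p a b → (a ⊛ V (suc p)) ≗ V p → b ≗ (onePS ⊕ (X ⊛ (a ⊛ b))) → (b ⊛ V (suc (suc p))) ≗ V (suc p)
  V-step p a b aV b≗ = begin≗
    b ⊛ (V (suc p) ⊖ (X ⊛ V p))
      ≈⟨ *-congˡ {x = b} (⊖-cong {a = V (suc p)} ≗-refl (*-congˡ {x = X} aV)) ⟨
    b ⊛ (V (suc p) ⊖ (X ⊛ (a ⊛ V (suc p))))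
      ≈⟨ psolve 4 (λ b v x a → b :⊛ (v :⊖ (x :⊛ (a :⊛ v))) :≗ (b :⊖ (x :⊛ (a :⊛ b))) :⊛ v) ≗-refl b (V (suc p)) X a ⟩
    (b ⊖ (X ⊛ (a ⊛ b))) ⊛ V (suc p)
      ≈⟨ *-congʳ {x = V (suc p)} (x≗y⊕z⇒x⊖z≗y b onePS (X ⊛ (a ⊛ b)) b≗) ⟩
    onePS ⊛ V (suc p)
      ≈⟨ *-identityˡ (V (suc p)) ⟩
    V (suc p) ∎≗

  quadratic : PS → PS → PS
  quadratic r F = (onePS ⊕ (X ⊛ F)) ⊕ (X ⊛ (X ⊛ (r ⊛ (F ⊛ F))))

  -- The equations say F = 1 / (1 - x H) and N = x Q / (1 - x H), so N = x Q F and H = 1 + x Q F.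
  quadratic-from-linear : ∀ Q H N F → H ≗ (onePS ⊕ N) → F ≗ (onePS ⊕ (X ⊛ (H ⊛ F))) →
                          N ≗ ((X ⊛ Q) ⊕ (X ⊛ (H ⊛ N))) → F ≗ quadratic Q F
  quadratic-from-linear Q H N F H≗ F≗ N≗ = begin≗
    F                                                 ≈⟨ F≗ ⟩
    onePS ⊕ (X ⊛ (H ⊛ F))                             ≈⟨ +-congˡ {x = onePS} (*-congˡ {x = X} (*-congʳ {x = F} (≗-trans H≗ (+-congˡ {x = onePS} N≗FXQ)))) ⟩
    onePS ⊕ (X ⊛ ((onePS ⊕ (F ⊛ (X ⊛ Q))) ⊛ F))       ≈⟨ psolve 3 (λ F X Q → :con 1ℚ :⊕ (X :⊛ ((:con 1ℚ :⊕ (F :⊛ (X :⊛ Q))) :⊛ F)) :≗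
                                                            (:con 1ℚ :⊕ (X :⊛ F)) :⊕ (X :⊛ (X :⊛ (Q :⊛ (F :⊛ F))))) ≗-refl F X Q ⟩
    quadratic Q F                                     ∎≗
    where
    N≗FXQ : N ≗ (F ⊛ (X ⊛ Q))
    N≗FXQ = begin≗
      N                                 ≈⟨ *-identityʳ N ⟨
      -- The unit is replaced by F(1 - xH); exchanging the factors turns this into F times N(1 - xH)
      -- = xQ, so 1 - xH is never inverted.
      N ⊛ onePS                         ≈⟨ *-congˡ {x = N} (x≗y⊕z⇒x⊖z≗y F onePS (X ⊛ (H ⊛ F)) F≗) ⟨
      N ⊛ (F ⊖ (X ⊛ (H ⊛ F)))           ≈⟨ psolve 4 (λ N F X H → N :⊛ (F :⊖ (X :⊛ (H :⊛ F))) :≗ F :⊛ (N :⊖ (X :⊛ (H :⊛ N)))) ≗-refl N F X H ⟩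
      F ⊛ (N ⊖ (X ⊛ (H ⊛ N)))           ≈⟨ *-congˡ {x = F} (x≗y⊕z⇒x⊖z≗y N (X ⊛ Q) (X ⊛ (H ⊛ N)) N≗) ⟩
      F ⊛ (X ⊛ Q)                       ∎≗

  -- The candidate for the root is `B` = 1 - x - 2x²rF, which makes the numerator equal to 2x²rF.
  -- Its constant term 1 identifies it with `sqrtPS Δ`, and the constant term 1 of r makes 2r
  -- invertible.
  quadratic-solution : ∀ k F → R (k ∸ 2) 0 ≡ 1ℚ → F ≗ quadratic (R (k ∸ 2)) F → F ≗ G k
  quadratic-solution k F r₀≡1 F≗ = begin≗
    F                                    ≈⟨ F≗2rF/2r ⟩
    (F ⊛ 2r) ⊛ inv 2r                    ≈⟨ *-congʳ {x = inv 2r} (λ n → sym (divX²-num n)) ⟩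
    G k ∎≗
    where
    r x² Δ B c₂ 2r : PS
    r  = R (k ∸ 2)
    x² = X ⊛ X
    Δ  = ((onePS ⊖ scale (fromℕℚ 2) X) ⊕ x²) ⊖ scale (fromℕℚ 4) (x² ⊛ r)
    c₂ = constPS (fromℕℚ 2)
    2r = scale (fromℕℚ 2) r
    B  = (onePS ⊖ X) ⊖ (X ⊛ (X ⊛ (F ⊛ 2r)))

    2r-zero : 2r 0 ≢ 0ℚ
    2r-zero eq with () ← trans (sym (cong (fromℕℚ 2 *_) r₀≡1)) eq

    F≗2rF/2r : F ≗ ((F ⊛ 2r) ⊛ inv 2r)
    F≗2rF/2r = ≗-sym (≗-trans (⊛-assoc F 2r (inv 2r)) (≗-trans (*-congˡ {x = F} (⊛-inv 2r 2r-zero)) (*-identityʳ F)))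

    -- B² - Δ = 4x²r (quadratic r F - F).
    B²≗Δ : (B ⊛ B) ≗ Δ
    B²≗Δ = begin≗
      B ⊛ B
        -- The solver knows constants only in the form `constPS`, so each `scale` is first turned
        -- into a product, and back again in the last step.
        ≈⟨ *-cong B≗ B≗ ⟩
      ((onePS ⊖ X) ⊖ (X ⊛ (X ⊛ (F ⊛ (c₂ ⊛ r))))) ⊛ ((onePS ⊖ X) ⊖ (X ⊛ (X ⊛ (F ⊛ (c₂ ⊛ r)))))
        ≈⟨ psolve 3 (λ F X r → let one = :con 1ℚ ; two = :con (fromℕℚ 2) ; four = :con (fromℕℚ 4)
                                   b = (one :⊖ X) :⊖ (X :⊛ (X :⊛ (F :⊛ (two :⊛ r))))
                                   e = (one :⊕ (X :⊛ F)) :⊕ (X :⊛ (X :⊛ (r :⊛ (F :⊛ F))))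
                               in b :⊛ b :≗ (((one :⊖ (two :⊛ X)) :⊕ (X :⊛ X)) :⊖ (four :⊛ ((X :⊛ X) :⊛ r)))
                                            :⊕ ((four :⊛ ((X :⊛ X) :⊛ r)) :⊛ (e :⊖ F))) ≗-refl F X r ⟩
      Δ′ ⊕ ((constPS (fromℕℚ 4) ⊛ (x² ⊛ r)) ⊛ (quadratic r F ⊖ F))
        ≈⟨ +-congˡ {x = Δ′} (*-congˡ {x = constPS (fromℕℚ 4) ⊛ (x² ⊛ r)} E⊖F≗0) ⟩
      Δ′ ⊕ ((constPS (fromℕℚ 4) ⊛ (x² ⊛ r)) ⊛ zeroPS)
        ≈⟨ ≗-trans (+-congˡ {x = Δ′} (zeroʳ (constPS (fromℕℚ 4) ⊛ (x² ⊛ r)))) (+-identityʳ Δ′) ⟩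
      Δ′
        ≈⟨ ⊖-cong (+-congʳ {x = x²} (⊖-cong {a = onePS} ≗-refl (constPS-⊛ (fromℕℚ 2) X))) (constPS-⊛ (fromℕℚ 4) (x² ⊛ r)) ⟩
      Δ ∎≗
      where
      Δ′ : PS
      Δ′ = ((onePS ⊖ (c₂ ⊛ X)) ⊕ x²) ⊖ (constPS (fromℕℚ 4) ⊛ (x² ⊛ r))
      B≗ : B ≗ ((onePS ⊖ X) ⊖ (X ⊛ (X ⊛ (F ⊛ (c₂ ⊛ r)))))
      B≗ = ⊖-cong {a = onePS ⊖ X} ≗-refl (*-congˡ {x = X} (*-congˡ {x = X} (*-congˡ {x = F} (≗-sym (constPS-⊛ (fromℕℚ 2) r)))))
      E⊖F≗0 : (quadratic r F ⊖ F) ≗ zeroPS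
      E⊖F≗0 n = trans (cong (λ z → quadratic r F n - z) (F≗ n)) (ℚₚ.+-inverseʳ (quadratic r F n))

    divX²-num : divX² ((onePS ⊖ X) ⊖ sqrtPS Δ) ≗ (F ⊛ 2r)
    divX²-num n = begin
      (onePS ⊖ X) (2 ℕ.+ n) - sqrtPS Δ (2 ℕ.+ n)
        ≡⟨ cong (λ z → (onePS ⊖ X) (2 ℕ.+ n) - z) (sqrtPS-unique Δ B B₀≡1 B²≗Δ (2 ℕ.+ n)) ⟩
      (onePS ⊖ X) (2 ℕ.+ n) - ((onePS ⊖ X) (2 ℕ.+ n) - (X ⊛ (X ⊛ (F ⊛ 2r))) (2 ℕ.+ n))
        ≡⟨ solve 2 (λ y z → y :- (y :- z) := z) refl ((onePS ⊖ X) (2 ℕ.+ n)) ((X ⊛ (X ⊛ (F ⊛ 2r))) (2 ℕ.+ n)) ⟩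
      (X ⊛ (X ⊛ (F ⊛ 2r))) (2 ℕ.+ n)
        ≡⟨ X-⊛-suc (X ⊛ (F ⊛ 2r)) (suc n) ⟩
      (X ⊛ (F ⊛ 2r)) (suc n)
        ≡⟨ X-⊛-suc (F ⊛ 2r) n ⟩
      (F ⊛ 2r) n ∎
      where
      B₀≡1 : B 0 ≡ 1ℚ
      B₀≡1 = cong (λ z → 1ℚ - z) (X-⊛-zero (X ⊛ (F ⊛ 2r)))

-- Binary trees: avoidance as a recursion, and its generating functions

module Trees where

  open PowerSeries
  open import Data.Bool using (Bool; true; false; _∧_; _∨_; if_then_else_)
  open import Data.Nat using (ℕ; zero; suc; _+_; _*_; _∸_; _≤_; _<_; s≤s)
  import Data.Nat.Properties as ℕₚ
  import Data.Rational as ℚ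
  import Data.Rational.Properties as ℚₚ
  open import Data.List using (List; []; _∷_; _++_; length; map; filterᵇ; cartesianProductWith)
  open import Algebra.Bundles using (CommutativeRing)
  open import Relation.Binary.PropositionalEquality
  open ≡-Reasoning

  -- ε is the empty pattern, desc b is 21 (adjacent letters if b, dashed otherwise), and for a pattern τ on
  -- p letters τ ⊕1 is τ-(p+1) and τ ⊕12 is τ-(p+1)(p+2).
  data Shape : Set where
    ε        : Shape
    desc     : Bool → Shape
    _⊕1 _⊕12 : Shape → Shape

  data Tree : Set where
    leaf : Tree
    node : Tree → Tree → Tree

  size : Tree → ℕ
  size leaf       = 0
  size (node l r) = suc (size l + size r)

  isLeaf : Tree → Bool
  isLeaf leaf       = true
  isLeaf (node _ _) = false

  -- The empty pattern occurs in every word. For `desc b`, the maximum and the first letter of a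
  -- nonempty R form an adjacent descent, which is an occurrence for either value of `b`; so R must
  -- be empty.
  avoids : Shape → Tree → Bool
  -- Whether the nonempty word of a tree, with a new maximum appended, avoids τ ⊕12 (false on leaf).
  avoidsTopped : Shape → Tree → Bool

  avoids ε         _          = false
  avoids (desc b)  leaf       = true
  avoids (desc b)  (node l r) = avoids (desc b) l ∧ isLeaf r
  avoids (τ ⊕1)    leaf       = true
  avoids (τ ⊕1)    (node l r) = avoids τ l ∧ avoids (τ ⊕1) r
  avoids (τ ⊕12)   leaf       = true
  -- With L empty, no letter precedes the maximum and no ascent can end there.
  avoids (τ ⊕12)   (node l r) = (isLeaf l ∨ avoidsTopped τ l) ∧ avoids (τ ⊕12) r

  avoidsTopped τ leaf       = false
  -- The first disjunct is the case of an empty R: avoiding τ in L also excludes occurrences inside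
  -- L m, since each has τ before its ascent. As `avoidsTopped τ r` is false on `leaf`, the second
  -- disjunct is the case of a nonempty R.
  avoidsTopped τ (node l r) = (avoids τ l ∧ isLeaf r) ∨ ((isLeaf l ∨ avoidsTopped τ l) ∧ avoidsTopped τ r)

  module _ {A : Set} where

    -- Grows at its upper end exactly as `sumR` does, so that counting turns one into the other term
    -- by term.
    concatBelow : ℕ → (ℕ → List A) → List A
    concatBelow zero    g = []
    concatBelow (suc n) g = concatBelow n g ++ g n

    concatBelow-cong : ∀ n {g h : ℕ → List A} → (∀ {i} → i < n → g i ≡ h i) → concatBelow n g ≡ concatBelow n h
    concatBelow-cong zero    g≗h = refl
    concatBelow-cong (suc n) g≗h = cong₂ _++_ (concatBelow-cong n (λ i<n → g≗h (ℕₚ.m<n⇒m<1+n i<n))) (g≗h (ℕₚ.n<1+n n))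

    count : (A → Bool) → List A → ℕ
    count p xs = length (filterᵇ p xs)

    count-++ : ∀ p xs ys → count p (xs ++ ys) ≡ count p xs + count p ys
    count-++ p []       ys = refl
    count-++ p (x ∷ xs) ys with p x
    ... | true  = cong suc (count-++ p xs ys)
    ... | false = count-++ p xs ys

    count-cong : ∀ {p q : A → Bool} → p ≗ q → ∀ xs → count p xs ≡ count q xs
    count-cong         p≗q []       = refl
    count-cong {p} {q} p≗q (x ∷ xs) with p x | q x | p≗q x
    ... | true  | _ | refl = cong suc (count-cong p≗q xs)
    ... | false | _ | refl = count-cong p≗q xs

    count-∨ : ∀ {p q r : A → Bool} → (∀ x → p x ≡ q x ∨ r x) → (∀ x → q x ∧ r x ≡ false) →
              ∀ xs → count p xs ≡ count q xs + count r xs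
    count-∨             p≗ q∧r []       = refl
    count-∨ {p} {q} {r} p≗ q∧r (x ∷ xs) with p x | q x | r x | p≗ x | q∧r x
    ... | _ | true  | false | refl | _ = cong suc (count-∨ p≗ q∧r xs)
    ... | _ | false | true  | refl | _ = trans (cong suc (count-∨ p≗ q∧r xs)) (sym (ℕₚ.+-suc (count q xs) (count r xs)))
    ... | _ | false | false | refl | _ = count-∨ p≗ q∧r xs

    count-singleton : ∀ p x {b} → p x ≡ b → count p (x ∷ []) ≡ (if b then 1 else 0)
    count-singleton p x {true}  px rewrite px = refl
    count-singleton p x {false} px rewrite px = refl

    count-concatBelow : ∀ p n g → fromℕℚ (count p (concatBelow n g)) ≡ sumR n (λ i → fromℕℚ (count p (g i)))
    count-concatBelow p zero    g = refl
    count-concatBelow p (suc n) g = begin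
      fromℕℚ (count p (concatBelow n g ++ g n))                    ≡⟨ cong fromℕℚ (count-++ p (concatBelow n g) (g n)) ⟩
      fromℕℚ (count p (concatBelow n g) + count p (g n))           ≡⟨ fromℕℚ-+ (count p (concatBelow n g)) (count p (g n)) ⟩
      fromℕℚ (count p (concatBelow n g)) ℚ.+ fromℕℚ (count p (g n)) ≡⟨ cong (ℚ._+ fromℕℚ (count p (g n))) (count-concatBelow p n g) ⟩
      sumR (suc n) (λ i → fromℕℚ (count p (g i)))                  ∎

  count-map : ∀ {A B : Set} (p : B → Bool) (h : A → B) xs → count p (map h xs) ≡ count (λ x → p (h x)) xs
  count-map p h []       = refl
  count-map p h (x ∷ xs) with p (h x)
  ... | true  = cong suc (count-map p h xs)
  ... | false = count-map p h xs

  count-const-false : ∀ {A : Set} (xs : List A) → count (λ _ → false) xs ≡ 0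
  count-const-false []       = refl
  count-const-false (x ∷ xs) = count-const-false xs

  count-cartesianProductWith : ∀ {A B C : Set} {h : A → B → C} {p : C → Bool} {q : A → Bool} {r : B → Bool} →
                               (∀ x y → p (h x y) ≡ q x ∧ r y) →
                               ∀ xs ys → count p (cartesianProductWith h xs ys) ≡ count q xs * count r ys
  count-cartesianProductWith                     p≗ []       ys = refl
  count-cartesianProductWith {h = h} {p} {q} {r} p≗ (x ∷ xs) ys = begin
    count p (map (h x) ys ++ cartesianProductWith h xs ys)              ≡⟨ count-++ p (map (h x) ys) _ ⟩
    count p (map (h x) ys) + count p (cartesianProductWith h xs ys)     ≡⟨ cong₂ _+_ (trans (count-map p (h x) ys) (count-cong (p≗ x) ys)) (count-cartesianProductWith p≗ xs ys) ⟩
    count (λ y → q x ∧ r y) ys + count q xs * count r ys                ≡⟨ head ⟩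
    count q (x ∷ xs) * count r ys                                       ∎
    where
    head : count (λ y → q x ∧ r y) ys + count q xs * count r ys ≡ count q (x ∷ xs) * count r ys
    head with q x
    ... | true  = refl
    ... | false = cong (_+ count q xs * count r ys) (count-const-false ys)

  -- The first argument bounds the height; a bound of n is enough for all trees of size n.
  treesOfHeight : ℕ → ℕ → List Tree
  treesOfHeight d       zero    = leaf ∷ []
  treesOfHeight zero    (suc n) = []
  treesOfHeight (suc d) (suc n) = concatBelow (suc n) (λ i → cartesianProductWith node (treesOfHeight d i) (treesOfHeight d (n ∸ i)))

  trees : ℕ → List Tree
  trees n = treesOfHeight n n

  treesOfHeight-≤ : ∀ {d n} → n ≤ d → treesOfHeight d n ≡ trees n
  treesOfHeight-≤ n≤d = go n≤d ℕₚ.≤-refl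
    where
    -- Two arbitrary heights are compared, because both decrease together while the subtrees may be
    -- much smaller than either.
    go : ∀ {d e n} → n ≤ d → n ≤ e → treesOfHeight d n ≡ treesOfHeight e n
    go {n = zero}                  _         _         = refl
    go {suc d} {suc e} {n = suc n} (s≤s n≤d) (s≤s n≤e) = concatBelow-cong (suc n) λ { {i} (s≤s i≤n) →
      cong₂ (cartesianProductWith node) (go (ℕₚ.≤-trans i≤n n≤d) (ℕₚ.≤-trans i≤n n≤e))
            (go (ℕₚ.≤-trans (ℕₚ.m∸n≤m n i) n≤d) (ℕₚ.≤-trans (ℕₚ.m∸n≤m n i) n≤e)) }

  trees-suc : ∀ n → trees (suc n) ≡ concatBelow (suc n) (λ i → cartesianProductWith node (trees i) (trees (n ∸ i)))
  trees-suc n = concatBelow-cong (suc n) λ { {i} (s≤s i≤n) →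
    cong₂ (cartesianProductWith node) (treesOfHeight-≤ i≤n) (treesOfHeight-≤ (ℕₚ.m∸n≤m n i)) }

  series : (Tree → Bool) → PS
  series p n = fromℕℚ (count p (trees n))

  series-∨ : ∀ {p q r : Tree → Bool} → (∀ t → p t ≡ q t ∨ r t) → (∀ t → q t ∧ r t ≡ false) →
             series p ≗ (series q ⊕ series r)
  series-∨ {q = q} {r} p≗ q∧r n = trans (cong fromℕℚ (count-∨ p≗ q∧r (trees n))) (fromℕℚ-+ (count q (trees n)) (count r (trees n)))

  -- A test that splits into independent tests of the two subtrees is counted by a convolution over
  -- the size of the left subtree.
  series-suc : ∀ {p q r : Tree → Bool} → (∀ x y → p (node x y) ≡ q x ∧ r y) →
               ∀ n → series p (suc n) ≡ (series q ⊛ series r) n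
  series-suc {p} {q} {r} p≗ n = begin
    fromℕℚ (count p (trees (suc n)))
      ≡⟨ cong (λ ts → fromℕℚ (count p ts)) (trees-suc n) ⟩
    fromℕℚ (count p (concatBelow (suc n) (λ i → cartesianProductWith node (trees i) (trees (n ∸ i)))))
      ≡⟨ count-concatBelow p (suc n) _ ⟩
    sumR (suc n) (λ i → fromℕℚ (count p (cartesianProductWith node (trees i) (trees (n ∸ i)))))
      ≡⟨ sumR-cong (suc n) (λ i → trans (cong fromℕℚ (count-cartesianProductWith p≗ (trees i) (trees (n ∸ i))))
                                        (fromℕℚ-* (count q (trees i)) (count r (trees (n ∸ i))))) ⟩
    (series q ⊛ series r) n ∎

  series-node : ∀ {p q r : Tree → Bool} → p leaf ≡ false → (∀ x y → p (node x y) ≡ q x ∧ r y) →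
                series p ≗ (X ⊛ (series q ⊛ series r))
  series-node {p} {q} {r} p-leaf p-node zero    = trans (cong fromℕℚ (count-singleton p leaf p-leaf)) (sym (X-⊛-zero (series q ⊛ series r)))
  series-node {p} {q} {r} p-leaf p-node (suc n) = trans (series-suc p-node n) (sym (X-⊛-suc (series q ⊛ series r) n))

  series-leaf-node : ∀ {p q r : Tree → Bool} → p leaf ≡ true → (∀ x y → p (node x y) ≡ q x ∧ r y) →
                     series p ≗ (onePS ⊕ (X ⊛ (series q ⊛ series r)))
  series-leaf-node {p} {q} {r} p-leaf p-node zero    = trans (cong fromℕℚ (count-singleton p leaf p-leaf))
    (sym (cong (ℚ.1ℚ ℚ.+_) (X-⊛-zero (series q ⊛ series r))))
  series-leaf-node {p} {q} {r} p-leaf p-node (suc n) = trans (series-suc p-node n)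
    (sym (trans (ℚₚ.+-identityˡ _) (X-⊛-suc (series q ⊛ series r) n)))

  open CommutativeRing commutativeRing using (+-cong; +-congˡ; +-congʳ; *-congˡ; *-congʳ; *-identityʳ; *-comm; zeroˡ; zeroʳ; +-identityʳ)
    renaming (refl to ≗-refl; sym to ≗-sym; trans to ≗-trans)

  series-false : series (λ _ → false) ≗ zeroPS
  series-false n = cong fromℕℚ (count-const-false (trees n))

  series-isLeaf : series isLeaf ≗ onePS
  series-isLeaf = ≗-trans (series-leaf-node refl (λ _ _ → refl))
    (≗-trans (+-congˡ {x = onePS} (≗-trans (*-congˡ {x = X} (≗-trans (*-congʳ {x = series (λ _ → false)} series-false) (zeroˡ (series (λ _ → false))))) (zeroʳ X))) (+-identityʳ onePS))

  series-⊕1 : ∀ τ → series (avoids (τ ⊕1)) ≗ (onePS ⊕ (X ⊛ (series (avoids τ) ⊛ series (avoids (τ ⊕1)))))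
  series-⊕1 τ = series-leaf-node refl (λ _ _ → refl)

  series-desc : ∀ b → series (avoids (desc b)) ≗ (onePS ⊕ (X ⊛ (onePS ⊛ series (avoids (desc b)))))
  series-desc b = ≗-trans (series-leaf-node refl (λ _ _ → refl)) (+-congˡ {x = onePS} (*-congˡ {x = X}
    (≗-trans (*-congˡ {x = series (avoids (desc b))} series-isLeaf) (*-comm (series (avoids (desc b))) onePS))))

  -- H counts by topped and N by avoidsTopped τ, that is, by topped on nonempty trees.
  series-⊕12 : ∀ τ → series (avoids (τ ⊕12)) ≗ quadratic (series (avoids τ)) (series (avoids (τ ⊕12)))
  series-⊕12 τ = quadratic-from-linear (series (avoids τ)) (series topped) (series (avoidsTopped τ)) (series (avoids (τ ⊕12)))
    (≗-trans (series-∨ {topped} (λ _ → refl) (λ { leaf → refl ; (node _ _) → refl })) (+-congʳ {x = series (avoidsTopped τ)} series-isLeaf))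
    (series-leaf-node refl (λ _ _ → refl))
    (≗-trans (series-∨ {avoidsTopped τ} {p₁} {p₂} (λ { leaf → refl ; (node _ _) → refl }) disjoint)
      (+-cong (≗-trans (series-node refl (λ _ _ → refl))
                       (*-congˡ {x = X} (≗-trans (*-congˡ {x = series (avoids τ)} series-isLeaf) (*-identityʳ (series (avoids τ))))))
              (series-node refl (λ _ _ → refl))))
    where
    topped p₁ p₂ : Tree → Bool
    topped t = isLeaf t ∨ avoidsTopped τ t
    p₁ leaf       = false
    p₁ (node l r) = avoids τ l ∧ isLeaf r
    p₂ leaf       = false
    p₂ (node l r) = topped l ∧ avoidsTopped τ r
    disjoint : ∀ t → p₁ t ∧ p₂ t ≡ false
    disjoint leaf = refl
    disjoint (node l leaf) with avoids τ l | topped l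
    ... | true  | true  = refl
    ... | true  | false = refl
    ... | false | _     = refl
    disjoint (node l (node _ _)) with avoids τ l
    ... | true  = refl
    ... | false = refl

-- Correctness of the tree recursion for pattern occurrences

module Occurrences where

  open Trees using (Shape; ε; desc; _⊕1; _⊕12; Tree; leaf; node; size; isLeaf; avoids; avoidsTopped)
  open import Data.Bool using (Bool; true; false; _∧_; _∨_)
  open import Data.Nat using (ℕ; suc; _+_; _≤_; _<_; s≤s)
  open import Data.Nat.Properties
  open import Data.List using (List; []; _∷_; _++_)
  open import Data.List.Properties using (++-assoc; ++-identityʳ; ∷-injective)
  open import Data.List.Relation.Unary.All as All using (All; []; _∷_)
  import Data.List.Relation.Unary.All.Properties as Allₚ
  open import Data.Product using (∃; _×_; _,_; proj₁; proj₂)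
  open import Data.Sum using (_⊎_; inj₁; inj₂)
  open import Data.Empty using (⊥-elim)
  open import Relation.Nullary using (¬_)
  open import Relation.Binary.PropositionalEquality

  -- The letters are s + 1, …, s + size t; left of the maximum all letters exceed those to its right.
  toWord : Tree → ℕ → List ℕ
  toWord leaf       s = []
  toWord (node l r) s = toWord l (s + size r) ++ suc (s + (size l + size r)) ∷ toWord r s

  toWord-bounds : ∀ t s → All (λ x → s < x × x ≤ s + size t) (toWord t s)
  toWord-bounds leaf       s = []
  toWord-bounds (node l r) s = Allₚ.++⁺
    (All.map (λ { (lo , hi) → ≤-<-trans (m≤m+n s (size r)) lo , ≤-trans hi (≤-trans (≤-reflexive left) (+-monoʳ-≤ s (n≤1+n _))) })
             (toWord-bounds l (s + size r)))
    ((s≤s (m≤m+n s _) , ≤-reflexive (sym (+-suc s (size l + size r)))) ∷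
     All.map (λ { (lo , hi) → lo , ≤-trans hi (+-monoʳ-≤ s (≤-trans (m≤n+m (size r) (size l)) (n≤1+n _))) }) (toWord-bounds r s))
    where
    left : s + size r + size l ≡ s + (size l + size r)
    left = trans (+-assoc s (size r) (size l)) (cong (s +_) (+-comm (size r) (size l)))

  -- An occurrence all of whose letters are below u; then u can serve as the next, larger letter of a longer pattern.
  data Occurs : Shape → List ℕ → ℕ → Set where
    occ-ε    : ∀ {π u} → Occurs ε π u
    occ-desc : ∀ {b π u} α x γ y β → π ≡ α ++ x ∷ γ ++ y ∷ β → y < x → x < u → (b ≡ true → γ ≡ []) → Occurs (desc b) π u
    occ-⊕1   : ∀ {τ π u} α x β → π ≡ α ++ x ∷ β → x < u → Occurs τ α x → Occurs (τ ⊕1) π u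
    occ-⊕12  : ∀ {τ π u} α x y β → π ≡ α ++ x ∷ y ∷ β → x < y → y < u → Occurs τ α x → Occurs (τ ⊕12) π u

  module _ {A : Set} where

    ++-split : ∀ ρ {π : List A} α {x β} → ρ ++ π ≡ α ++ x ∷ β →
               (∃ λ δ → ρ ≡ α ++ x ∷ δ × β ≡ δ ++ π) ⊎ (∃ λ δ → α ≡ ρ ++ δ × π ≡ δ ++ x ∷ β)
    ++-split []      α        eq = inj₂ (α , refl , eq)
    ++-split (z ∷ ρ) []       refl = inj₁ (ρ , refl , refl)
    ++-split (z ∷ ρ) (w ∷ α)  eq with ∷-injective eq
    ... | refl , eq′ with ++-split ρ α eq′
    ...   | inj₁ (δ , p , q) = inj₁ (δ , cong (z ∷_) p , q)
    ...   | inj₂ (δ , p , q) = inj₂ (δ , cong (z ∷_) p , q)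

    ++-∷-≢[] : ∀ (α : List A) {x β} → ¬ ([] ≡ α ++ x ∷ β)
    ++-∷-≢[] []      ()
    ++-∷-≢[] (_ ∷ _) ()

    ++-∷-∷-≢[x] : ∀ (α : List A) {x y z β} → ¬ (z ∷ [] ≡ α ++ x ∷ y ∷ β)
    ++-∷-∷-≢[x] []          ()
    ++-∷-∷-≢[x] (_ ∷ [])    ()
    ++-∷-∷-≢[x] (_ ∷ _ ∷ α) ()

    ++-∷-nonempty : ∀ (γ : List A) {y β} → ∃ λ z → ∃ λ ζ → γ ++ y ∷ β ≡ z ∷ ζ
    ++-∷-nonempty []      = _ , _ , refl
    ++-∷-nonempty (_ ∷ _) = _ , _ , refl

    All-middle : ∀ {P : A → Set} α {x β} → All P (α ++ x ∷ β) → P x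
    All-middle α ps = All.head (Allₚ.++⁻ʳ α ps)

  Occurs-weaken : ∀ {τ π u v} → u ≤ v → Occurs τ π u → Occurs τ π v
  Occurs-weaken u≤v occ-ε                            = occ-ε
  Occurs-weaken u≤v (occ-desc α x γ y β eq y<x x<u g) = occ-desc α x γ y β eq y<x (<-≤-trans x<u u≤v) g
  Occurs-weaken u≤v (occ-⊕1 α x β eq x<u o)          = occ-⊕1 α x β eq (<-≤-trans x<u u≤v) o
  Occurs-weaken u≤v (occ-⊕12 α x y β eq x<y y<u o)   = occ-⊕12 α x y β eq x<y (<-≤-trans y<u u≤v) o

  Occurs-++ʳ : ∀ {τ π u} σ → Occurs τ π u → Occurs τ (π ++ σ) u
  Occurs-++ʳ σ occ-ε = occ-ε
  Occurs-++ʳ σ (occ-desc α x γ y β refl y<x x<u g) =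
    occ-desc α x γ y (β ++ σ) (trans (++-assoc α _ σ) (cong (λ z → α ++ x ∷ z) (++-assoc γ _ σ))) y<x x<u g
  Occurs-++ʳ σ (occ-⊕1 α x β refl x<u o)         = occ-⊕1 α x (β ++ σ) (++-assoc α _ σ) x<u o
  Occurs-++ʳ σ (occ-⊕12 α x y β refl x<y y<u o)  = occ-⊕12 α x y (β ++ σ) (++-assoc α _ σ) x<y y<u o

  Occurs-++ˡ : ∀ {τ π u} ρ → Occurs τ π u → Occurs τ (ρ ++ π) u
  Occurs-++ˡ ρ occ-ε                               = occ-ε
  Occurs-++ˡ ρ (occ-desc α x γ y β refl y<x x<u g) = occ-desc (ρ ++ α) x γ y β (sym (++-assoc ρ α _)) y<x x<u g
  Occurs-++ˡ ρ (occ-⊕1 α x β refl x<u o)           = occ-⊕1 (ρ ++ α) x β (sym (++-assoc ρ α _)) x<u (Occurs-++ˡ ρ o)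
  Occurs-++ˡ ρ (occ-⊕12 α x y β refl x<y y<u o)    = occ-⊕12 (ρ ++ α) x y β (sym (++-assoc ρ α _)) x<y y<u (Occurs-++ˡ ρ o)

  -- Every letter of the occurrence is below `u`, so none can be taken from ρ. It serves for ρ = L m
  -- when `u` is bounded by a letter of R.
  Occurs-drop : ∀ {τ u} ρ {π} → All (u ≤_) ρ → Occurs τ (ρ ++ π) u → Occurs τ π u
  Occurs-drop ρ ρ≥u occ-ε = occ-ε
  Occurs-drop ρ ρ≥u (occ-desc α x γ y β eq y<x x<u g) with ++-split ρ α eq
  ... | inj₁ (δ , refl , _)    = ⊥-elim (<⇒≱ x<u (All-middle α ρ≥u))
  ... | inj₂ (δ , refl , eq′)  = occ-desc δ x γ y β eq′ y<x x<u g
  Occurs-drop ρ ρ≥u (occ-⊕1 α x β eq x<u o) with ++-split ρ α eq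
  ... | inj₁ (δ , refl , _)    = ⊥-elim (<⇒≱ x<u (All-middle α ρ≥u))
  ... | inj₂ (δ , refl , eq′)  = occ-⊕1 δ x β eq′ x<u (Occurs-drop ρ (All.map (≤-trans (<⇒≤ x<u)) ρ≥u) o)
  Occurs-drop ρ ρ≥u (occ-⊕12 α x y β eq x<y y<u o) with ++-split ρ α eq
  ... | inj₁ (δ , refl , _)    = ⊥-elim (<⇒≱ (<-trans x<y y<u) (All-middle α ρ≥u))
  ... | inj₂ (δ , refl , eq′)  = occ-⊕12 δ x y β eq′ x<y y<u (Occurs-drop ρ (All.map (≤-trans (<⇒≤ (<-trans x<y y<u))) ρ≥u) o)

  -- The position of the final ascent relative to m. In `across` its lower letter is m itself:
  -- impossible when a letter of R follows, but exactly the junction when the appended maximum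
  -- follows.
  data Split12 (τ : Shape) (ρ : List ℕ) (m : ℕ) (σ : List ℕ) (u : ℕ) : Set where
    in-left  : Occurs (τ ⊕12) (ρ ++ m ∷ []) u → Split12 τ ρ m σ u
    across   : ∀ y σ′ → σ ≡ y ∷ σ′ → m < y → Occurs τ ρ m → Split12 τ ρ m σ u
    in-right : ∀ δ x y β → σ ≡ δ ++ x ∷ y ∷ β → x < y → y < u → Occurs τ (ρ ++ m ∷ δ) x → Split12 τ ρ m σ u

  split12 : ∀ {τ u} ρ m σ → Occurs (τ ⊕12) (ρ ++ m ∷ σ) u → Split12 τ ρ m σ u
  split12 ρ m σ (occ-⊕12 α x y β eq x<y y<u o) with ++-split ρ α eq
  ... | inj₁ ([] , refl , refl)     = in-left (occ-⊕12 α x m [] (++-assoc α _ _) x<y y<u o)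
  ... | inj₁ (_ ∷ δ , refl , refl)  = in-left (occ-⊕12 α x y (δ ++ m ∷ []) (++-assoc α _ _) x<y y<u o)
  ... | inj₂ ([] , refl , refl)     = across y β refl x<y (subst (λ z → Occurs _ z m) (++-identityʳ ρ) o)
  ... | inj₂ (_ ∷ δ , refl , refl)  = in-right δ x y β refl x<y y<u o

  -- The part of the occurrence before its ascent is τ, and it lies within ρ. Hence, when R is
  -- empty, testing L for τ also accounts for the ascents inside L m.
  Occurs-⊕12-last : ∀ {τ u} ρ m → All (_< m) ρ → Occurs (τ ⊕12) (ρ ++ m ∷ []) u → Occurs τ ρ m
  Occurs-⊕12-last ρ m ρ<m (occ-⊕12 α x y β eq x<y y<u o) with ++-split ρ α eq
  ... | inj₁ (δ , refl , _)      = Occurs-++ʳ _ (Occurs-weaken (<⇒≤ (All-middle α ρ<m)) o)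
  ... | inj₂ (δ , _ , eq′)       = ⊥-elim (++-∷-∷-≢[x] δ eq′)

  module Node (l r : Tree) (s : ℕ) where

    m : ℕ
    m = suc (s + (size l + size r))

    left right : List ℕ
    left = toWord l (s + size r)
    right = toWord r s

    size-left<m : s + size r + size l < m
    size-left<m = s≤s (≤-reflexive (trans (+-assoc s (size r) (size l)) (cong (s +_) (+-comm (size r) (size l)))))

    left<m : All (_< m) left
    left<m = All.map (λ b → ≤-<-trans (proj₂ b) size-left<m) (toWord-bounds l (s + size r))

    size-right<m : s + size r < m
    size-right<m = s≤s (+-monoʳ-≤ s (m≤n+m (size r) (size l)))

    right<m : All (_< m) right
    right<m = All.map (λ b → ≤-<-trans (proj₂ b) size-right<m) (toWord-bounds r s)

    left≥ : ∀ {x} → x ≤ s + size r → All (x ≤_) (left ++ m ∷ [])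
    left≥ x≤ = Allₚ.++⁺ (All.map (λ b → ≤-trans x≤ (<⇒≤ (proj₁ b))) (toWord-bounds l (s + size r))) (≤-trans x≤ (<⇒≤ size-right<m) ∷ [])

    m<u : ∀ {u} → s + suc (size l + size r) < u → m < u
    m<u = ≤-<-trans (≤-reflexive (sym (+-suc s (size l + size r))))

    right≤ : All (_≤ s + size r) right
    right≤ = All.map proj₂ (toWord-bounds r s)

    drop-left : ∀ {τ x} δ → x ≤ s + size r → Occurs τ (left ++ m ∷ δ) x → Occurs τ δ x
    drop-left δ x≤ o = Occurs-drop (left ++ m ∷ []) (left≥ x≤) (subst (λ z → Occurs _ z _) (sym (++-assoc left _ δ)) o)

    extend-right : ∀ {τ u} σ → Occurs τ σ u → Occurs τ (left ++ m ∷ σ) u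
    extend-right σ o = subst (λ z → Occurs _ z _) (++-assoc left _ σ) (Occurs-++ˡ (left ++ m ∷ []) o)

    extend-left : ∀ {τ u} σ → Occurs τ (left ++ m ∷ []) u → Occurs τ (left ++ m ∷ σ) u
    extend-left σ o = subst (λ z → Occurs _ z _) (++-assoc left _ σ) (Occurs-++ʳ σ o)

  toWord-node-nonempty : ∀ l r s → ∃ λ x → ∃ λ β → toWord (node l r) s ≡ x ∷ β
  toWord-node-nonempty l r s with toWord l (s + size r)
  ... | []    = _ , _ , refl
  ... | _ ∷ _ = _ , _ , refl

  ∧-false : ∀ a {b} → a ∧ b ≡ false → a ≡ false ⊎ b ≡ false
  ∧-false true  e = inj₂ e
  ∧-false false e = inj₁ refl

  ∧-falseˡ : ∀ {a b} → a ≡ false → a ∧ b ≡ false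
  ∧-falseˡ refl = refl

  ∧-falseʳ : ∀ a {b} → b ≡ false → a ∧ b ≡ false
  ∧-falseʳ true  e = e
  ∧-falseʳ false e = refl

  ∨-falseᵢ : ∀ {a b} → a ≡ false → b ≡ false → a ∨ b ≡ false
  ∨-falseᵢ refl refl = refl

  ∨-false : ∀ a {b} → a ∨ b ≡ false → a ≡ false × b ≡ false
  ∨-false false e = refl , e

  topped : Shape → Tree → Bool
  topped τ t = isLeaf t ∨ avoidsTopped τ t

  -- Mutual with `occurs⇒¬topped`, as `avoids (τ ⊕12)` tests the left subtree with `topped` and
  -- `avoidsTopped` falls back on `avoids τ`. The cases of an appended letter locate the last
  -- letter, or the final ascent, relative to m; if it lies in R, `drop-left` puts the whole
  -- occurrence there.
  occurs⇒¬avoids : ∀ τ t s {u} → Occurs τ (toWord t s) u → avoids τ t ≡ false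
  occurs⇒¬topped : ∀ τ t s b {u} → s + size t < b → Occurs (τ ⊕12) (toWord t s ++ b ∷ []) u → topped τ t ≡ false

  occurs⇒¬avoids ε t s o = refl
  occurs⇒¬avoids (desc b) leaf s (occ-desc α x γ y β eq _ _ _) = ⊥-elim (++-∷-≢[] α eq)
  occurs⇒¬avoids (desc b) (node l (node r r′)) s o = ∧-falseʳ (avoids (desc b) l) refl
  occurs⇒¬avoids (desc b) (node l leaf) s (occ-desc α x γ y β eq y<x x<u g) = ∧-falseˡ (occurs⇒¬avoids (desc b) l _ in-l)
    where
    open Node l leaf s
    in-l : Occurs (desc b) left _
    in-l with ++-split left α eq
    ... | inj₂ (δ , _ , eq₁) with ++-∷-nonempty γ
    ...   | _ , _ , e = ⊥-elim (++-∷-∷-≢[x] δ (trans eq₁ (cong (λ z → δ ++ x ∷ z) e)))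
    in-l | inj₁ (δ , e₁ , e₂) with ++-split δ γ (sym e₂)
    ...   | inj₁ (δ′ , refl , _)  = occ-desc α x γ y δ′ e₁ y<x x<u g
    -- Here y would be the maximum m, although y < x and x is a letter of L.
    ...   | inj₂ (δ′ , _ , e₃)    = ⊥-elim (<⇒≱ (<-trans y<x (All-middle α (subst (All (_< m)) e₁ left<m)))
                                                (All-middle δ′ (subst (All (m ≤_)) e₃ (≤-refl ∷ []))))
  occurs⇒¬avoids (τ ⊕1) leaf s (occ-⊕1 α x β eq _ _) = ⊥-elim (++-∷-≢[] α eq)
  occurs⇒¬avoids (τ ⊕1) (node l r) s (occ-⊕1 α x β eq x<u o) with ++-split (toWord l (s + size r)) α eq
  ... | inj₁ (δ , e , _) = ∧-falseˡ (occurs⇒¬avoids τ l (s + size r) {x} (subst (λ z → Occurs τ z x) (sym e) (Occurs-++ʳ (x ∷ δ) o)))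
  ... | inj₂ ([] , refl , refl) = ∧-falseˡ (occurs⇒¬avoids τ l (s + size r) (subst (λ z → Occurs τ z x) (++-identityʳ _) o))
  ... | inj₂ (_ ∷ δ , refl , e) with ∷-injective e
  ...   | refl , e′ = ∧-falseʳ (avoids τ l) (occurs⇒¬avoids (τ ⊕1) r s
                        (occ-⊕1 δ x β e′ x<u (drop-left δ (All-middle δ (subst (All (_≤ s + size r)) e′ right≤)) o)))
    where open Node l r s
  occurs⇒¬avoids (τ ⊕12) leaf s (occ-⊕12 α x y β eq _ _ _) = ⊥-elim (++-∷-≢[] α eq)
  occurs⇒¬avoids (τ ⊕12) (node l r) s o with split12 (toWord l (s + size r)) _ _ o
  ... | in-left o′ = ∧-falseˡ (occurs⇒¬topped τ l (s + size r) _ (Node.size-left<m l r s) o′)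
  -- Here y would be the first letter of R, which is below m.
  ... | across y σ′ e m<y _ = ⊥-elim (<-asym m<y (All-middle [] (subst (All (_< m)) e right<m)))
    where open Node l r s
  ... | in-right δ x y β e x<y y<u o′ = ∧-falseʳ (topped τ l) (occurs⇒¬avoids (τ ⊕12) r s
          (occ-⊕12 δ x y β e x<y y<u (drop-left δ (All-middle δ (subst (All (_≤ s + size r)) e right≤)) o′)))
    where open Node l r s

  occurs⇒¬topped τ leaf s b _ (occ-⊕12 α x y β eq _ _ _) = ⊥-elim (++-∷-∷-≢[x] α eq)
  occurs⇒¬topped τ (node l r) s b {u} size<b o with split12 (toWord l (s + size r)) _ _ (subst (λ z → Occurs (τ ⊕12) z u) (++-assoc (toWord l (s + size r)) _ _) o)
  occurs⇒¬topped τ (node l leaf) s b size<b o | in-left o′ =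
    ∨-falseᵢ (∧-falseˡ (occurs⇒¬avoids τ l (s + 0) (Occurs-⊕12-last left m left<m o′))) (∧-falseʳ (topped τ l) refl)
    where open Node l leaf s
  occurs⇒¬topped τ (node l r@(node _ _)) s b size<b o | in-left o′ =
    ∨-falseᵢ (∧-falseʳ (avoids τ l) refl) (∧-falseˡ (occurs⇒¬topped τ l (s + size r) _ size-left<m o′))
    where open Node l r s
  -- Here y is the appended letter `b`: the ascent from m to `b` completes an occurrence of τ in L.
  occurs⇒¬topped τ (node l leaf) s b size<b o | across y σ′ e m<y o′ =
    ∨-falseᵢ (∧-falseˡ (occurs⇒¬avoids τ l (s + 0) o′)) (∧-falseʳ (topped τ l) refl)
  occurs⇒¬topped τ (node l r@(node r₁ r₂)) s b size<b o | across y σ′ e m<y o′ with toWord-node-nonempty r₁ r₂ s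
  ... | z , ζ , e′ = ⊥-elim (<-asym m<y (subst (_< m) y≡z (All-middle [] (subst (All (_< m)) e′ right<m))))
    where
    open Node l r s
    y≡z : z ≡ y
    y≡z = proj₁ (∷-injective (trans (cong (_++ b ∷ []) (sym e′)) e))
  occurs⇒¬topped τ (node l r) s b {u} size<b o | in-right δ x y β e x<y y<u o′ with ++-split (toWord r s) δ e
  ... | inj₂ (δ′ , _ , e′) = ⊥-elim (++-∷-∷-≢[x] δ′ e′)
  ... | inj₁ (δ′ , e′ , _) = nonleaf r refl (occurs⇒¬topped τ r s b right<b (occ-⊕12 δ x y β e x<y y<u
          (drop-left δ (All-middle δ (subst (All (_≤ s + size r)) e′ right≤)) o′)))
    where
    open Node l r s
    right<b : s + size r < b
    right<b = <-trans size-right<m (≤-<-trans (≤-reflexive (sym (+-suc s (size l + size r)))) size<b)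
    -- Since `topped` is true on `leaf`, the hypothesis forces a node, on which `topped` and
    -- `avoidsTopped` coincide.
    nonleaf : ∀ r′ → r ≡ r′ → topped τ r′ ≡ false → topped τ (node l r′) ≡ false
    nonleaf (node _ _) _ e = ∨-falseᵢ (∧-falseʳ (avoids τ l) refl) (∧-falseʳ (topped τ l) e)

  topped-node : ∀ τ l r → topped τ (node l r) ≡ false →
                (r ≡ leaf × avoids τ l ≡ false) ⊎ topped τ l ≡ false ⊎ topped τ r ≡ false
  topped-node τ l leaf e with ∧-false (avoids τ l) (proj₁ (∨-false (avoids τ l ∧ true) e))
  ... | inj₁ e′ = inj₁ (refl , e′)
  topped-node τ l (node _ _) e = inj₂ (∧-false (topped τ l) (proj₂ (∨-false (avoids τ l ∧ false) e)))

  -- The occurrence that is built may end in the maximum of the word, so `u` has to exceed all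
  -- letters.
  ¬avoids⇒occurs : ∀ τ t s {u} → s + size t < u → avoids τ t ≡ false → Occurs τ (toWord t s) u
  ¬topped⇒occurs : ∀ τ t s b {u} → s + size t < b → b < u → topped τ t ≡ false → Occurs (τ ⊕12) (toWord t s ++ b ∷ []) u

  ¬avoids⇒occurs ε t s size<u e = occ-ε
  ¬avoids⇒occurs (desc b) (node l leaf) s {u} size<u e with ∧-false (avoids (desc b) l) e
  ... | inj₁ e′ = extend-left [] (Occurs-++ʳ (m ∷ []) (¬avoids⇒occurs (desc b) l (s + 0) (<-trans size-left<m (m<u size<u)) e′))
    where open Node l leaf s
  ¬avoids⇒occurs (desc b) (node l r@(node r₁ r₂)) s {u} size<u e with toWord-node-nonempty r₁ r₂ s
  -- The maximum and the letter right after it: with the gap `[]` this descent meets the adjacency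
  -- condition too.
  ... | y , β , e′ = occ-desc left m [] y β (cong (λ z → left ++ m ∷ z) e′) (All-middle [] (subst (All (_< m)) e′ right<m)) (m<u size<u) (λ _ → refl)
    where open Node l r s
  ¬avoids⇒occurs (τ ⊕1) (node l r) s {u} size<u e with ∧-false (avoids τ l) e
  ... | inj₁ e′ = occ-⊕1 left m right refl (m<u size<u) (¬avoids⇒occurs τ l (s + size r) size-left<m e′)
    where open Node l r s
  ... | inj₂ e′ = extend-right right (¬avoids⇒occurs (τ ⊕1) r s (<-trans size-right<m (m<u size<u)) e′)
    where open Node l r s
  ¬avoids⇒occurs (τ ⊕12) (node l r) s {u} size<u e with ∧-false (topped τ l) e
  ... | inj₁ e′ = extend-left right (¬topped⇒occurs τ l (s + size r) m size-left<m (m<u size<u) e′)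
    where open Node l r s
  ... | inj₂ e′ = extend-right right (¬avoids⇒occurs (τ ⊕12) r s (<-trans size-right<m (m<u size<u)) e′)
    where open Node l r s

  ¬topped⇒occurs τ (node l r) s b {u} size<b b<u e = subst (λ z → Occurs (τ ⊕12) z u) (sym (++-assoc left _ _)) (found (topped-node τ l r e))
    where
    open Node l r s
    found : (r ≡ leaf × avoids τ l ≡ false) ⊎ topped τ l ≡ false ⊎ topped τ r ≡ false → Occurs (τ ⊕12) (left ++ m ∷ right ++ b ∷ []) u
    found (inj₁ (refl , e′))    = occ-⊕12 left m b [] refl (m<u size<b) b<u (¬avoids⇒occurs τ l (s + size r) size-left<m e′)
    found (inj₂ (inj₁ e′))      = extend-left (right ++ b ∷ []) (¬topped⇒occurs τ l (s + size r) m size-left<m (<-trans (m<u size<b) b<u) e′)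
    found (inj₂ (inj₂ e′))      = extend-right (right ++ b ∷ []) (¬topped⇒occurs τ r s b (<-trans size-right<m (m<u size<b)) b<u e′)

-- From the inductive occurrences to the Boolean containment test

module Containment where

  open Trees using (Shape; ε; desc; _⊕1; _⊕12; size; avoids)
  open Occurrences
  open import Data.Bool using (Bool; true; false; _∧_; _∨_; not; T)
  open import Data.Bool.ListAction using (all)
  open import Data.Bool.Properties using (∧-assoc; T-∧; T-≡)
  open import Data.Nat using (ℕ; zero; suc; _+_; _≤_; _<_; _<ᵇ_; _≡ᵇ_; z≤n; s≤s)
  open import Data.Nat.Properties
  open import Data.List using (List; []; _∷_; _++_; length; map; zip; applyUpTo)
  open import Data.List.Properties using (++-assoc; map-++; length-++; length-map)
  open import Data.List.Membership.Propositional using (_∈_; lose; find)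
  open import Data.List.Membership.Propositional.Properties using (∈-++⁺ˡ; ∈-++⁺ʳ; ∈-++⁻; ∈-map⁺; ∈-map⁻)
  open import Data.List.Relation.Unary.Any using (here; there)
  import Data.List.Relation.Unary.Any.Properties as Anyₚ
  open import Data.List.Relation.Unary.All as All using (All; []; _∷_)
  import Data.List.Relation.Unary.All.Properties as Allₚ
  open import Data.List.Relation.Binary.Sublist.Propositional using (_⊆_; []; _∷_; _∷ʳ_; minimum)
  import Data.List.Relation.Binary.Sublist.Propositional.Properties as Subₚ
  open import Data.Product using (∃; _×_; _,_; proj₁; proj₂)
  open import Data.Sum using (inj₁; inj₂)
  open import Data.Empty using (⊥-elim)
  open import Data.Unit using (tt)
  open import Function using (_∘_)
  open import Function.Bundles using (module Equivalence)
  open import Relation.Binary.PropositionalEquality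

  private
    variable
      A B : Set

  -- An arbitrary starting position makes the indexed suffixes of a word instances of the same
  -- function.
  indexedFrom : ℕ → List ℕ → List (ℕ × ℕ)
  indexedFrom s []      = []
  indexedFrom s (x ∷ π) = (s , x) ∷ indexedFrom (suc s) π

  indexed≡indexedFrom : ∀ π → indexed π ≡ indexedFrom 1 π
  indexed≡indexedFrom π = go π (λ i → i) 1 (λ _ → refl)
    where
    go : ∀ π f s → (∀ i → suc (f i) ≡ s + i) → zip (map suc (applyUpTo f (length π))) π ≡ indexedFrom s π
    go []      f s f≗ = refl
    go (x ∷ π) f s f≗ = cong₂ _∷_ (cong (_, x) (trans (f≗ 0) (+-identityʳ s)))
                                  (go π (f ∘ suc) (suc s) (λ i → trans (f≗ (suc i)) (+-suc s i)))

  map-proj₂-indexedFrom : ∀ s π → map proj₂ (indexedFrom s π) ≡ π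
  map-proj₂-indexedFrom s []      = refl
  map-proj₂-indexedFrom s (x ∷ π) = cong (x ∷_) (map-proj₂-indexedFrom (suc s) π)

  indexedFrom-++ : ∀ s α {x β} → indexedFrom s (α ++ x ∷ β) ≡ indexedFrom s α ++ (s + length α , x) ∷ indexedFrom (suc (s + length α)) β
  indexedFrom-++ s []      rewrite +-identityʳ s = refl
  indexedFrom-++ s (a ∷ α) rewrite +-suc s (length α) = cong ((s , a) ∷_) (indexedFrom-++ (suc s) α)

  indexedFrom-split : ∀ s π ys {i v zs} → indexedFrom s π ≡ ys ++ (i , v) ∷ zs →
                      ∃ λ α → ∃ λ β → π ≡ α ++ v ∷ β × ys ≡ indexedFrom s α × i ≡ s + length α × zs ≡ indexedFrom (suc i) β
  indexedFrom-split s (x ∷ π) []       refl = [] , π , refl , refl , sym (+-identityʳ s) , refl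
  indexedFrom-split s (x ∷ π) (y ∷ ys) eq with Data.List.Properties.∷-injective eq
  ... | refl , eq′ with indexedFrom-split (suc s) π ys eq′
  ...   | α , β , p , q , r , t = x ∷ α , β , cong (x ∷_) p , cong (y ∷_) q , trans r (sym (+-suc s (length α))) , t
  indexedFrom-split s [] []       ()
  indexedFrom-split s [] (_ ∷ _)  ()

  ⊆-split : ∀ os {z : A} {zs xs} → os ++ z ∷ zs ⊆ xs →
            ∃ λ ys → ∃ λ ws → xs ≡ ys ++ z ∷ ws × os ⊆ ys × zs ⊆ ws
  ⊆-split []       (y ∷ʳ p) with ⊆-split [] p
  ... | ys , ws , eq , q , r = y ∷ ys , ws , cong (y ∷_) eq , y ∷ʳ q , r
  ⊆-split []       (refl ∷ p) = [] , _ , refl , [] , p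
  ⊆-split (o ∷ os) (y ∷ʳ p) with ⊆-split (o ∷ os) p
  ... | ys , ws , eq , q , r = y ∷ ys , ws , cong (y ∷_) eq , y ∷ʳ q , r
  ⊆-split (o ∷ os) (refl ∷ p) with ⊆-split os p
  ... | ys , ws , eq , q , r = o ∷ ys , ws , cong (o ∷_) eq , refl ∷ q , r

  -- A position records the number of letters before it; consecutive positions thereby become an
  -- empty gap between two letters.
  ⊆-indexedFrom-split : ∀ s π os {i v zs} → os ++ (i , v) ∷ zs ⊆ indexedFrom s π →
                        ∃ λ α → ∃ λ β → π ≡ α ++ v ∷ β × os ⊆ indexedFrom s α × i ≡ s + length α × zs ⊆ indexedFrom (suc i) β
  ⊆-indexedFrom-split s π os p with ⊆-split os p
  ... | ys , ws , eq , q , r with indexedFrom-split s π ys eq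
  ...   | α , β , e₁ , refl , e₂ , refl = α , β , e₁ , q , e₂ , r

  ⊆-lift : ∀ s {os} π → os ⊆ π → ∃ λ occ → occ ⊆ indexedFrom s π × map proj₂ occ ≡ os
  ⊆-lift s []      []       = [] , [] , refl
  ⊆-lift s (x ∷ π) (y ∷ʳ p) with ⊆-lift (suc s) π p
  ... | occ , q , e = occ , (s , x) ∷ʳ q , e
  ⊆-lift s (x ∷ π) (refl ∷ p) with ⊆-lift (suc s) π p
  ... | occ , q , e = (s , x) ∷ occ , refl ∷ q , cong (x ∷_) e

  ∈-subs⁻ : ∀ k (xs : List A) {os} → os ∈ subs k xs → os ⊆ xs × length os ≡ k
  ∈-subs⁻ zero    xs       (here refl) = minimum xs , refl
  ∈-subs⁻ (suc k) (x ∷ xs) os∈ with ∈-++⁻ (map (x ∷_) (subs k xs)) os∈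
  ... | inj₂ os∈′ = let p , q = ∈-subs⁻ (suc k) xs os∈′ in x ∷ʳ p , q
  ... | inj₁ os∈′ with ∈-map⁻ (x ∷_) os∈′
  ...   | _ , os∈″ , refl = let p , q = ∈-subs⁻ k xs os∈″ in refl ∷ p , cong suc q

  ∈-subs⁺ : ∀ {xs os : List A} → os ⊆ xs → os ∈ subs (length os) xs
  ∈-subs⁺ []                        = here refl
  ∈-subs⁺ {os = []}     (y ∷ʳ p)    = here refl
  ∈-subs⁺ {os = o ∷ os} (y ∷ʳ p)    = ∈-++⁺ʳ (map (y ∷_) (subs (length os) _)) (∈-subs⁺ p)
  ∈-subs⁺               (refl ∷ p)  = ∈-++⁺ˡ (∈-map⁺ (_ ∷_) (∈-subs⁺ p))

  lastOr : A → List A → A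
  lastOr z []       = z
  lastOr z (y ∷ ys) = lastOr y ys

  -- The last pair of the left block is shared: the next flag links it to the right block, so it
  -- reappears in front of `zs`.
  adjOK-++ : ∀ bs {cs} z os {zs} → length os ≡ length bs →
             adjOK (bs ++ cs) (z ∷ os ++ zs) ≡ adjOK bs (z ∷ os) ∧ adjOK cs (lastOr z os ∷ zs)
  adjOK-++ []       z []       eq = refl
  adjOK-++ (b ∷ bs) z (o ∷ os) eq = trans (cong ((not b ∨ (proj₁ o ≡ᵇ suc (proj₁ z))) ∧_) (adjOK-++ bs o os (suc-injective eq)))
                                         (sym (∧-assoc (not b ∨ (proj₁ o ≡ᵇ suc (proj₁ z))) _ _))

  -- This removes the extra leading flag of `flags` together with the dummy pair placed before the
  -- occurrence.
  adjOK-false∷ : ∀ bs z os → adjOK (false ∷ bs) (z ∷ os) ≡ adjOK bs os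
  adjOK-false∷ []       z []       = refl
  adjOK-false∷ (b ∷ bs) z []       = refl
  adjOK-false∷ bs       z (o ∷ os) = refl

  OrderIso : List (ℕ × ℕ) → Set
  OrderIso ps = ∀ {p q} → p ∈ ps → q ∈ ps → (proj₁ p < proj₁ q → proj₂ p < proj₂ q) × (proj₂ p < proj₂ q → proj₁ p < proj₁ q)

  orderIsoᵇ⇒OrderIso : ∀ ps → T (orderIsoᵇ ps) → OrderIso ps
  orderIsoᵇ⇒OrderIso ps ok {a , x} {b , y} p∈ q∈
    with a <ᵇ b in ab | x <ᵇ y in xy | All.lookup (Allₚ.all⁺ _ ps (All.lookup (Allₚ.all⁺ _ ps ok) p∈)) q∈
  ... | true  | true  | _ = (λ _ → <ᵇ⇒< x y (Equivalence.from T-≡ xy)) , (λ _ → <ᵇ⇒< a b (Equivalence.from T-≡ ab))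
  ... | false | false | _ = (λ a<b → ⊥-elim (subst T ab (<⇒<ᵇ a<b))) , (λ x<y → ⊥-elim (subst T xy (<⇒<ᵇ x<y)))

  all-false : ∀ (p : A → Bool) xs → all p xs ≡ false → ∃ λ x → x ∈ xs × p x ≡ false
  all-false p (x ∷ xs) eq with p x in px
  ... | false = x , here refl , px
  ... | true  = let y , y∈ , py = all-false p xs eq in y , there y∈ , py

  OrderIso⇒orderIsoᵇ : ∀ ps → OrderIso ps → T (orderIsoᵇ ps)
  OrderIso⇒orderIsoᵇ ps iso with orderIsoᵇ ps in eq
  ... | true  = tt
  ... | false with all-false _ ps eq
  ...   | (a , x) , p∈ , eq′ with all-false _ ps eq′
  ...     | (b , y) , q∈ , eq″ with a <ᵇ b in ab | x <ᵇ y in xy | iso p∈ q∈ | eq″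
  ...       | true  | false | f , _ | _ = subst T xy (<⇒<ᵇ (f (<ᵇ⇒< a b (Equivalence.from T-≡ ab))))
  ...       | false | true  | _ , g | _ = subst T ab (<⇒<ᵇ (g (<ᵇ⇒< x y (Equivalence.from T-≡ xy))))

  -- For a pattern letter above all earlier ones, order isomorphism of the longer word amounts to
  -- that of the shorter one and an upper bound on its values. This is the bound that `Occurs`
  -- carries.
  OrderIso-snoc⁻ : ∀ ps {a x} → All (λ p → proj₁ p < a) ps → OrderIso (ps ++ (a , x) ∷ []) → OrderIso ps × All (λ p → proj₂ p < x) ps
  OrderIso-snoc⁻ ps ps<a iso = (λ p∈ q∈ → iso (∈-++⁺ˡ p∈) (∈-++⁺ˡ q∈)) ,
    All.tabulate (λ p∈ → proj₁ (iso (∈-++⁺ˡ p∈) (∈-++⁺ʳ ps (here refl))) (All.lookup ps<a p∈))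

  OrderIso-snoc⁺ : ∀ ps {a x} → All (λ p → proj₁ p < a) ps → All (λ p → proj₂ p < x) ps → OrderIso ps → OrderIso (ps ++ (a , x) ∷ [])
  OrderIso-snoc⁺ ps ps<a ps<x iso p∈ q∈ with ∈-++⁻ ps p∈ | ∈-++⁻ ps q∈
  ... | inj₁ p∈′         | inj₁ q∈′         = iso p∈′ q∈′
  ... | inj₁ p∈′         | inj₂ (here refl) = (λ _ → All.lookup ps<x p∈′) , (λ _ → All.lookup ps<a p∈′)
  ... | inj₂ (here refl) | inj₁ q∈′         = (λ a< → ⊥-elim (<-asym a< (All.lookup ps<a q∈′))) , (λ x< → ⊥-elim (<-asym x< (All.lookup ps<x q∈′)))
  ... | inj₂ (here refl) | inj₂ (here refl) = (λ a< → ⊥-elim (<-irrefl refl a<)) , (λ x< → ⊥-elim (<-irrefl refl x<))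

  OrderIso-[] : OrderIso []
  OrderIso-[] ()

  zip-++ : ∀ (xs : List A) {xs′} (ys : List B) {ys′} → length ys ≡ length xs → zip (xs ++ xs′) (ys ++ ys′) ≡ zip xs ys ++ zip xs′ ys′
  zip-++ []       []       eq = refl
  zip-++ (x ∷ xs) (y ∷ ys) eq = cong ((x , y) ∷_) (zip-++ xs ys (suc-injective eq))

  All-zipˡ : ∀ {P : A → Set} {xs} (ys : List B) → All P xs → All (λ p → P (proj₁ p)) (zip xs ys)
  All-zipˡ ys       []         = []
  All-zipˡ []       (px ∷ pxs) = []
  All-zipˡ (y ∷ ys) (px ∷ pxs) = px ∷ All-zipˡ ys pxs

  All-zipʳ⁺ : ∀ {P : B → Set} (xs : List A) {ys} → All P ys → All (λ p → P (proj₂ p)) (zip xs ys)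
  All-zipʳ⁺ []       _          = []
  All-zipʳ⁺ (x ∷ xs) []         = []
  All-zipʳ⁺ (x ∷ xs) (py ∷ pys) = py ∷ All-zipʳ⁺ xs pys

  All-zipʳ⁻ : ∀ {P : B → Set} (xs : List A) ys → length ys ≡ length xs → All (λ p → P (proj₂ p)) (zip xs ys) → All P ys
  All-zipʳ⁻ []       []       eq []         = []
  All-zipʳ⁻ (x ∷ xs) (y ∷ ys) eq (py ∷ pys) = py ∷ All-zipʳ⁻ xs ys (suc-injective eq) pys

  length-split : ∀ (xs : List A) {xs′} (os : List B) → length os ≡ length (xs ++ xs′) →
                 ∃ λ os₁ → ∃ λ os₂ → os ≡ os₁ ++ os₂ × length os₁ ≡ length xs × length os₂ ≡ length xs′
  length-split []       os       eq = [] , os , refl , refl , eq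
  length-split (x ∷ xs) (o ∷ os) eq with length-split xs os (suc-injective eq)
  ... | os₁ , os₂ , e , e₁ , e₂ = o ∷ os₁ , os₂ , cong (o ∷_) e , cong suc e₁ , e₂

  letters : Shape → List ℕ
  letters ε        = []
  letters (desc b) = 2 ∷ 1 ∷ []
  letters (τ ⊕1)   = letters τ ++ suc (length (letters τ)) ∷ []
  letters (τ ⊕12)  = letters τ ++ suc (length (letters τ)) ∷ suc (suc (length (letters τ))) ∷ []

  -- Adjacency flags with one extra flag in front of the first letter, so that every letter has its own flag.
  flags : Shape → List Bool
  flags ε        = []
  flags (desc b) = false ∷ b ∷ []
  flags (τ ⊕1)   = flags τ ++ false ∷ []
  flags (τ ⊕12)  = flags τ ++ false ∷ true ∷ []

  letters-≤ : ∀ τ → All (_≤ length (letters τ)) (letters τ)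
  letters-≤ ε        = []
  letters-≤ (desc b) = ≤-refl ∷ s≤s z≤n ∷ []
  letters-≤ (τ ⊕1)   rewrite length-++ (letters τ) {suc (length (letters τ)) ∷ []} | +-comm (length (letters τ)) 1 =
    Allₚ.++⁺ (All.map m≤n⇒m≤1+n (letters-≤ τ)) (≤-refl ∷ [])
  letters-≤ (τ ⊕12)  rewrite length-++ (letters τ) {suc (length (letters τ)) ∷ suc (suc (length (letters τ))) ∷ []} | +-comm (length (letters τ)) 2 =
    Allₚ.++⁺ (All.map (m≤n⇒m≤1+n ∘ m≤n⇒m≤1+n) (letters-≤ τ)) (n≤1+n _ ∷ ≤-refl ∷ [])

  length-flags : ∀ τ → length (flags τ) ≡ length (letters τ)
  length-flags ε        = refl
  length-flags (desc b) = refl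
  length-flags (τ ⊕1)   = trans (length-++ (flags τ)) (trans (cong (_+ 1) (length-flags τ)) (sym (length-++ (letters τ))))
  length-flags (τ ⊕12)  = trans (length-++ (flags τ)) (trans (cong (_+ 2) (length-flags τ)) (sym (length-++ (letters τ))))

  -- The data that `containsᵇ` tests, together with the bound of `Occurs`. The pair `(0 , 0)` is a
  -- dummy predecessor of the first letter, matching the extra first flag.
  record Embedding (w : List ℕ) (bs : List Bool) (s : ℕ) (π : List ℕ) (u : ℕ) : Set where
    constructor embedding
    field
      occ     : List (ℕ × ℕ)
      sub     : occ ⊆ indexedFrom s π
      len     : length occ ≡ length w
      adjOcc  : T (adjOK bs ((0 , 0) ∷ occ))
      iso     : OrderIso (zip w (map proj₂ occ))
      bounded : All (λ z → proj₂ z < u) occ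

  module _ (τ : Shape) where

    private
      w : List ℕ
      w = letters τ

      k : ℕ
      k = length w

    zip-snoc : ∀ (occ : List (ℕ × ℕ)) {cs : List ℕ} {zs} → length occ ≡ k → zip (w ++ cs) (map proj₂ (occ ++ zs)) ≡ zip w (map proj₂ occ) ++ zip cs (map proj₂ zs)
    zip-snoc occ len = trans (cong (zip _) (map-++ proj₂ occ _)) (zip-++ w (map proj₂ occ) (trans (length-map proj₂ occ) len))

    letters-<-zip : ∀ (occ : List (ℕ × ℕ)) → All (λ p → proj₁ p < suc k) (zip w (map proj₂ occ))
    letters-<-zip occ = All-zipˡ (map proj₂ occ) (All.map s≤s (letters-≤ τ))

    values-<-zip : ∀ {x} (occ : List (ℕ × ℕ)) → All (λ z → proj₂ z < x) occ → All (λ p → proj₂ p < x) (zip w (map proj₂ occ))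
    values-<-zip occ occ<x = All-zipʳ⁺ w (Allₚ.map⁺ occ<x)

    zip-<-values : ∀ {x} (occ : List (ℕ × ℕ)) → length occ ≡ k → All (λ p → proj₂ p < x) (zip w (map proj₂ occ)) → All (λ z → proj₂ z < x) occ
    zip-<-values occ len zs<x = Allₚ.map⁻ (All-zipʳ⁻ w (map proj₂ occ) (trans (length-map proj₂ occ) len) zs<x)

    flags-snoc : ∀ occ {cs zs} → length occ ≡ k →
                 adjOK (flags τ ++ cs) ((0 , 0) ∷ occ ++ zs) ≡ adjOK (flags τ) ((0 , 0) ∷ occ) ∧ adjOK cs (lastOr (0 , 0) occ ∷ zs)
    flags-snoc occ len = adjOK-++ (flags τ) (0 , 0) occ (trans len (sym (length-flags τ)))

    flags-snoc⁻ : ∀ occ {cs zs} → length occ ≡ k → T (adjOK (flags τ ++ cs) ((0 , 0) ∷ occ ++ zs)) →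
                  T (adjOK (flags τ) ((0 , 0) ∷ occ)) × T (adjOK cs (lastOr (0 , 0) occ ∷ zs))
    flags-snoc⁻ occ len ok = Equivalence.to (T-∧ {adjOK (flags τ) ((0 , 0) ∷ occ)}) (subst T (flags-snoc occ len) ok)

    flags-snoc⁺ : ∀ occ {cs zs} → length occ ≡ k → T (adjOK (flags τ) ((0 , 0) ∷ occ)) →
                  T (adjOK cs (lastOr (0 , 0) occ ∷ zs)) → T (adjOK (flags τ ++ cs) ((0 , 0) ∷ occ ++ zs))
    flags-snoc⁺ occ len ok ok′ = subst T (sym (flags-snoc occ len)) (Equivalence.from T-∧ (ok , ok′))

  adjacent⇒≡[] : ∀ i (γ : List A) → T (suc i + length γ ≡ᵇ suc i) → γ ≡ []
  adjacent⇒≡[] i []      _  = refl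
  adjacent⇒≡[] i (c ∷ γ) ok = ⊥-elim (m+1+n≢m (suc i) (≡ᵇ⇒≡ (suc i + length (c ∷ γ)) (suc i) ok))

  embedding⇒occurs : ∀ τ {s π u} → Embedding (letters τ) (flags τ) s π u → Occurs τ π u
  embedding⇒occurs ε _ = occ-ε
  embedding⇒occurs (desc b) {s} {π} (embedding ((i , x) ∷ (j , y) ∷ []) sub refl ok iso (x<u ∷ _ ∷ []))
    with ⊆-indexedFrom-split s π [] sub
  ... | α , β , refl , _ , refl , sub′ with ⊆-indexedFrom-split _ β [] sub′
  ...   | γ , β′ , refl , _ , refl , _ = occ-desc α x γ y β′ refl (proj₁ (iso (there (here refl)) (here refl)) (s≤s (s≤s z≤n))) x<u adjacent
    where
    adjacent : b ≡ true → γ ≡ []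
    adjacent refl = adjacent⇒≡[] (s + length α) γ (proj₁ (Equivalence.to T-∧ ok))
  embedding⇒occurs (τ ⊕1) {s} {π} (embedding occ sub len ok iso bounded) with length-split (letters τ) occ len
  ... | os , (i , x) ∷ [] , refl , len₁ , refl with ⊆-indexedFrom-split s π os sub
  ...   | α , β , refl , sub′ , _ , _
    with OrderIso-snoc⁻ _ (letters-<-zip τ os) (subst OrderIso (zip-snoc τ os len₁) iso)
  ...     | iso′ , os<x = occ-⊕1 α x β refl (All.head (Allₚ.++⁻ʳ os bounded))
    (embedding⇒occurs τ (embedding os sub′ len₁ (proj₁ (flags-snoc⁻ τ os len₁ ok)) iso′ (zip-<-values τ os len₁ os<x)))
  embedding⇒occurs (τ ⊕12) {s} {π} (embedding occ sub len ok iso bounded) with length-split (letters τ) occ len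
  ... | os , (i , x) ∷ (j , y) ∷ [] , refl , len₁ , refl with ⊆-indexedFrom-split s π os sub
  ...   | α , β , refl , sub′ , refl , sub″ with ⊆-indexedFrom-split _ β [] sub″
  ...     | γ , β′ , refl , _ , refl , _
    -- The flag `true` between the last two letters forces the gap γ to be empty.
    with adjacent⇒≡[] (s + length α) γ (proj₁ (Equivalence.to T-∧ (proj₂ (flags-snoc⁻ τ os len₁ ok))))
  ... | refl
    -- The two top letters are removed one at a time, the larger one first, since each must exceed
    -- everything before it.
    with OrderIso-snoc⁻ (zip (letters τ) (map proj₂ os) ++ (suc (length (letters τ)) , x) ∷ []) {suc (suc (length (letters τ)))} {y}
           (Allₚ.++⁺ (All.map m<n⇒m<1+n (letters-<-zip τ os)) (≤-refl ∷ []))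
           (subst OrderIso (trans (zip-snoc τ os len₁) (sym (++-assoc (zip (letters τ) (map proj₂ os)) _ _))) iso)
  ... | iso₁ , <y with OrderIso-snoc⁻ _ (letters-<-zip τ os) iso₁
  ... | iso₂ , <x = occ-⊕12 α x y β′ refl (All.head (Allₚ.++⁻ʳ (zip (letters τ) (map proj₂ os)) <y)) (All.head (All.tail (Allₚ.++⁻ʳ os bounded)))
    (embedding⇒occurs τ (embedding os sub′ len₁ (proj₁ (flags-snoc⁻ τ os len₁ ok)) iso₂ (zip-<-values τ os len₁ <x)))

  ⊆-indexedFrom-++ : ∀ s α x β {os zs} → os ⊆ indexedFrom s α → zs ⊆ indexedFrom (suc (s + length α)) β →
                     os ++ (s + length α , x) ∷ zs ⊆ indexedFrom s (α ++ x ∷ β)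
  ⊆-indexedFrom-++ s α x β p q = subst (_ ⊆_) (sym (indexedFrom-++ s α)) (Subₚ.++⁺ p (refl ∷ q))

  OrderIso-21 : ∀ {x y} → y < x → OrderIso ((2 , x) ∷ (1 , y) ∷ [])
  OrderIso-21 y<x (here refl)         (here refl)         = (λ p → ⊥-elim (<-irrefl refl p)) , (λ p → ⊥-elim (<-irrefl refl p))
  OrderIso-21 y<x (here refl)         (there (here refl)) = (λ { (s≤s ()) }) , (λ x<y → ⊥-elim (<-asym x<y y<x))
  OrderIso-21 y<x (there (here refl)) (here refl)         = (λ _ → y<x) , (λ _ → s≤s (s≤s z≤n))
  OrderIso-21 y<x (there (here refl)) (there (here refl)) = (λ p → ⊥-elim (<-irrefl refl p)) , (λ p → ⊥-elim (<-irrefl refl p))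

  occurs⇒embedding : ∀ τ {s π u} → Occurs τ π u → Embedding (letters τ) (flags τ) s π u
  occurs⇒embedding ε _ = embedding [] (minimum _) refl tt OrderIso-[] []
  occurs⇒embedding (desc b) {s} (occ-desc α x γ y β refl y<x x<u adj) = embedding
    ((s + length α , x) ∷ (suc (s + length α) + length γ , y) ∷ [])
    (⊆-indexedFrom-++ s α x _ (minimum _) (⊆-indexedFrom-++ _ γ y β (minimum _) (minimum _)))
    refl (adjacent b adj) (OrderIso-21 y<x) (x<u ∷ <-trans y<x x<u ∷ [])
    where
    adjacent : ∀ b → (b ≡ true → γ ≡ []) → T (adjOK (false ∷ b ∷ []) ((0 , 0) ∷ (s + length α , x) ∷ (suc (s + length α) + length γ , y) ∷ []))
    adjacent false _   = tt
    adjacent true  adj with refl ← adj refl = Equivalence.from T-∧ (≡⇒≡ᵇ _ _ (+-identityʳ (suc (s + length α))) , tt)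
  occurs⇒embedding (τ ⊕1) {s} (occ-⊕1 α x β refl x<u o) with occurs⇒embedding τ {s} o
  ... | embedding os sub len ok iso bounded = embedding
    (os ++ (s + length α , x) ∷ [])
    (⊆-indexedFrom-++ s α x β sub (minimum _))
    (trans (length-++ os) (trans (cong (_+ 1) len) (sym (length-++ (letters τ)))))
    (flags-snoc⁺ τ os len ok tt)
    (subst OrderIso (sym (zip-snoc τ os len)) (OrderIso-snoc⁺ _ (letters-<-zip τ os) (values-<-zip τ os bounded) iso))
    (Allₚ.++⁺ (All.map (λ z<x → <-trans z<x x<u) bounded) (x<u ∷ []))
  occurs⇒embedding (τ ⊕12) {s} (occ-⊕12 α x y β refl x<y y<u o) with occurs⇒embedding τ {s} o
  ... | embedding os sub len ok iso bounded = embedding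
    -- The summand 0 is the length of the empty gap, as `⊆-indexedFrom-++` produces it.
    (os ++ (s + length α , x) ∷ (suc (s + length α) + 0 , y) ∷ [])
    (⊆-indexedFrom-++ s α x _ sub (⊆-indexedFrom-++ _ [] y β [] (minimum _)))
    (trans (length-++ os) (trans (cong (_+ 2) len) (sym (length-++ (letters τ)))))
    (flags-snoc⁺ τ os len ok (Equivalence.from T-∧ (≡⇒≡ᵇ _ _ (+-identityʳ (suc (s + length α))) , tt)))
    (subst OrderIso (trans (++-assoc (zip (letters τ) (map proj₂ os)) _ _) (sym (zip-snoc τ os len)))
      (OrderIso-snoc⁺ (zip (letters τ) (map proj₂ os) ++ (suc (length (letters τ)) , x) ∷ [])
        (Allₚ.++⁺ (All.map m<n⇒m<1+n (letters-<-zip τ os)) (≤-refl ∷ []))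
        (Allₚ.++⁺ (All.map (λ z<x → <-trans z<x x<y) (values-<-zip τ os bounded)) (x<y ∷ []))
        (OrderIso-snoc⁺ _ (letters-<-zip τ os) (values-<-zip τ os bounded) iso)))
    (Allₚ.++⁺ (All.map (λ z<x → <-trans z<x (<-trans x<y y<u)) bounded) (<-trans x<y y<u ∷ y<u ∷ []))

  module _ {τ : Shape} {bs : List Bool} (flags-τ : flags τ ≡ false ∷ bs) where

    contains⇒occurs : ∀ {π u} → All (_< u) π → T (containsᵇ π (gpat (letters τ) bs)) → Occurs τ π u
    contains⇒occurs {π} {u} π<u c with find (Anyₚ.any⁻ _ (subs (length (letters τ)) (indexed π)) c)
    ... | occ , occ∈ , ok with ∈-subs⁻ (length (letters τ)) (indexed π) occ∈ | Equivalence.to T-∧ ok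
    ...   | sub , len | adj , iso = embedding⇒occurs τ (embedding occ sub′ len
      (subst T (trans (sym (adjOK-false∷ bs (0 , 0) occ)) (cong (λ cs → adjOK cs ((0 , 0) ∷ occ)) (sym flags-τ))) adj)
      (orderIsoᵇ⇒OrderIso _ iso)
      (All.tabulate λ z∈ → All.lookup π<u (subst (_ ∈_) (map-proj₂-indexedFrom 1 π) (∈-map⁺ proj₂ (Subₚ.Any-resp-⊆ sub′ z∈)))))
      where
      sub′ : occ ⊆ indexedFrom 1 π
      sub′ = subst (occ ⊆_) (indexed≡indexedFrom π) sub

    occurs⇒contains : ∀ {π u} → Occurs τ π u → T (containsᵇ π (gpat (letters τ) bs))
    occurs⇒contains {π} o with occurs⇒embedding τ {1} o
    ... | embedding occ sub len adj iso _ = Anyₚ.any⁺ _ (lose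
      (subst₂ (λ k xs → occ ∈ subs k xs) len (sym (indexed≡indexedFrom π)) (∈-subs⁺ sub))
      (Equivalence.from T-∧
        (subst T (trans (cong (λ cs → adjOK cs ((0 , 0) ∷ occ)) flags-τ) (adjOK-false∷ bs (0 , 0) occ)) adj ,
         OrderIso⇒orderIsoᵇ _ iso)))

    -- Letters of the word are at most `size t`, so the bound `suc (size t)` admits every
    -- occurrence.
    avoidsᵇ-toWord : ∀ t → avoidsᵇ (toWord t 0) (gpat (letters τ) bs) ≡ avoids τ t
    avoidsᵇ-toWord t with avoids τ t in eq | containsᵇ (toWord t 0) (gpat (letters τ) bs) in eq′
    ... | true  | false = refl
    ... | false | true  = refl
    ... | true  | true  with () ← trans (sym eq) (occurs⇒¬avoids τ t 0
      (contains⇒occurs {u = suc (size t)} (All.map (λ b → s≤s (proj₂ b)) (toWord-bounds t 0)) (Equivalence.from T-≡ eq′)))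
    ... | false | false = ⊥-elim (subst T eq′ (occurs⇒contains (¬avoids⇒occurs τ t 0 {suc (size t)} ≤-refl eq)))

-- The 132-avoiding permutations are the words of trees

module Permutations where

  open Trees using (Tree; leaf; node; size; avoids; trees; treesOfHeight; concatBelow; count; count-map; count-cong)
  open Occurrences using (toWord; toWord-bounds; ++-split; All-middle; module Node)
  open Containment using (indexed≡indexedFrom; map-proj₂-indexedFrom; ⊆-lift; ∈-subs⁻; ∈-subs⁺; orderIsoᵇ⇒OrderIso; letters; flags; avoidsᵇ-toWord)
  open import Data.Bool using (Bool; true; false; _∧_; not; T; T?)
  open import Data.Bool.Properties using (T-∧; T-∨; T-≡; T-not-≡)
  open import Data.Nat using (ℕ; zero; suc; _+_; _∸_; _≤_; _<_; _<ᵇ_; _≡ᵇ_; z≤n; s≤s; _≟_)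
  open import Data.Nat.Properties
  open import Data.List using (List; []; _∷_; _++_; length; map; concatMap; filterᵇ; upTo; cartesianProductWith)
  open import Data.List.Properties using (length-++; ++-identityʳ; ∷-injective)
  open import Data.List.Membership.Propositional using (_∈_; _∉_; lose; find)
  open import Data.List.Membership.Propositional.Properties
  open import Data.List.Membership.Propositional.Properties.WithK using (unique∧set⇒bag)
  open import Data.List.Membership.DecPropositional _≟_ using (_∈?_)
  open import Data.List.Relation.Binary.BagAndSetEquality using (∼bag⇒↭)
  open import Data.List.Relation.Binary.Permutation.Propositional using (_↭_)
  open import Data.List.Relation.Binary.Permutation.Propositional.Properties using (↭-length; filter-↭)
  open import Data.List.Relation.Unary.Any using (here; there)
  import Data.List.Relation.Unary.Any.Properties as Anyₚ
  open import Data.List.Relation.Unary.All as All using (All; []; _∷_)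
  import Data.List.Relation.Unary.All.Properties as Allₚ
  open import Data.List.Relation.Unary.AllPairs using ([]; _∷_)
  open import Data.List.Relation.Unary.Unique.Propositional using (Unique)
  import Data.List.Relation.Unary.Unique.Propositional.Properties as Uniqueₚ
  open import Data.List.Relation.Binary.Sublist.Propositional using (_⊆_; []; _∷_; _∷ʳ_; minimum; ⊆-refl; ⊆-trans; from∈; to∈)
  import Data.List.Relation.Binary.Sublist.Propositional.Properties as Subₚ
  open import Data.Product using (∃; _×_; _,_; proj₁; proj₂)
  open import Data.Sum using (inj₁; inj₂)
  open import Data.Empty using (⊥-elim)
  open import Data.Unit using (tt)
  open import Function using (_∘_; mk⇔)
  open import Function.Bundles using (module Equivalence)
  open import Relation.Nullary using (¬_; yes; no)
  open import Relation.Binary.PropositionalEquality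

  private
    variable
      A B C : Set

  Unique-resp-⊆ : ∀ {os xs : List A} → os ⊆ xs → Unique xs → Unique os
  Unique-resp-⊆ []          _        = []
  Unique-resp-⊆ (y ∷ʳ p)    (_ ∷ u)  = Unique-resp-⊆ p u
  Unique-resp-⊆ (refl ∷ p)  (px ∷ u) = Subₚ.All-resp-⊆ p px ∷ Unique-resp-⊆ p u

  ++-∷-⊆ : ∀ (α : List A) {m β} → α ++ β ⊆ α ++ m ∷ β
  ++-∷-⊆ α = Subₚ.++⁺ (⊆-refl {x = α}) (_ ∷ʳ ⊆-refl)

  ⊆-++-split : ∀ {os} (xs : List A) {ys} → os ⊆ xs ++ ys → ∃ λ os₁ → ∃ λ os₂ → os ≡ os₁ ++ os₂ × os₁ ⊆ xs × os₂ ⊆ ys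
  ⊆-++-split []       p           = [] , _ , refl , [] , p
  ⊆-++-split (x ∷ xs) (.x ∷ʳ p)   = let os₁ , os₂ , e , p₁ , p₂ = ⊆-++-split xs p in os₁ , os₂ , e , x ∷ʳ p₁ , p₂
  ⊆-++-split (x ∷ xs) (refl ∷ p)  = let os₁ , os₂ , e , p₁ , p₂ = ⊆-++-split xs p in x ∷ os₁ , os₂ , cong (x ∷_) e , refl ∷ p₁ , p₂

  Within : ℕ → ℕ → ℕ → Set
  Within lo hi x = lo < x × x ≤ hi

  below-max : ∀ {n s} α {β} → Unique (α ++ s + suc n ∷ β) → All (Within s (s + suc n)) (α ++ s + suc n ∷ β) →
              All (Within s (s + n)) (α ++ β)
  below-max {n} {s} α {β} u bs = All.tabulate below
    where
    ≢max : ∀ {x} → x ∈ α ++ β → x ≢ s + suc n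
    ≢max x∈ refl with ∈-++⁻ α x∈
    ... | inj₁ x∈α with (x≢ ∷ _) ∷ _ ← Unique-resp-⊆ (Subₚ.++⁺ (from∈ x∈α) (refl ∷ minimum β)) u = x≢ refl
    ... | inj₂ x∈β with (x≢ ∷ _) ∷ _ ← Unique-resp-⊆ (Subₚ.++⁺ (minimum α) (refl ∷ from∈ x∈β)) u = x≢ refl
    below : ∀ {x} → x ∈ α ++ β → Within s (s + n) x
    below {x} x∈ with All.lookup bs (Subₚ.Any-resp-⊆ (++-∷-⊆ α) x∈)
    ... | lo , hi = lo , ≤-pred (subst (x <_) (+-suc s n) (≤∧≢⇒< hi (≢max x∈)))

  without-max : ∀ {n s π} → s + suc n ∉ π → All (Within s (s + suc n)) π → All (Within s (s + n)) π
  without-max {n} {s} m∉π bs = All.tabulate λ {x} x∈ → let lo , hi = All.lookup bs x∈ in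
    lo , ≤-pred (subst (x <_) (+-suc s n) (≤∧≢⇒< hi (λ { refl → m∉π x∈ })))

  length-++-∷ : ∀ (α : List A) {x β} → length (α ++ x ∷ β) ≡ suc (length α + length β)
  length-++-∷ α {β = β} = trans (length-++ α) (+-suc (length α) (length β))

  -- The pigeonhole principle, by removing the top value of the interval, which occurs at most once.
  unique-length : ∀ n {s π} → Unique π → All (Within s (s + n)) π → length π ≤ n
  unique-length n       {s} {[]}    u bs = z≤n
  unique-length zero    {s} {x ∷ π} u ((lo , hi) ∷ _) = ⊥-elim (<⇒≱ lo (subst (x ≤_) (+-identityʳ s) hi))
  unique-length (suc n) {s} {π@(_ ∷ _)} u bs with s + suc n ∈? π
  ... | no  m∉π = m≤n⇒m≤1+n (unique-length n u (without-max m∉π bs))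
  ... | yes m∈π with ∈-∃++ m∈π
  ...   | α , β , eq = ≤-trans (≤-reflexive (trans (cong length eq) (trans (length-++-∷ α) (cong suc (sym (length-++ α))))))
                         (s≤s (unique-length n (Unique-resp-⊆ (++-∷-⊆ α) (subst Unique eq u))
                                               (below-max α (subst Unique eq u) (subst (All _) eq bs))))

  unique-length-∸ : ∀ {lo hi π} → lo ≤ hi → Unique π → All (Within lo hi) π → lo + length π ≤ hi
  unique-length-∸ {lo} {hi} lo≤hi u bs = ≤-trans
    (+-monoʳ-≤ lo (unique-length (hi ∸ lo) u (subst (λ h → All (Within lo h) _) (sym (m+[n∸m]≡n lo≤hi)) bs)))
    (≤-reflexive (m+[n∸m]≡n lo≤hi))

  -- All letters of this pattern are separated by dashes, so positions can be forgotten and an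
  -- occurrence is a sublist.
  Avoids132 : List ℕ → Set
  Avoids132 π = ∀ {a c b} → a ∷ c ∷ b ∷ [] ⊆ π → a < b → ¬ (b < c)

  Avoids132-resp-⊆ : ∀ {π ρ} → π ⊆ ρ → Avoids132 ρ → Avoids132 π
  Avoids132-resp-⊆ p av q = av (⊆-trans q p)

  <⇒<ᵇ-true : ∀ {x y} → x < y → (x <ᵇ y) ≡ true
  <⇒<ᵇ-true x<y = Equivalence.to T-≡ (<⇒<ᵇ x<y)

  ≤⇒<ᵇ-false : ∀ {x y} → y ≤ x → (x <ᵇ y) ≡ false
  ≤⇒<ᵇ-false {x} {y} y≤x with x <ᵇ y in eq
  ... | false = refl
  ... | true  = ⊥-elim (<⇒≱ (<ᵇ⇒< x y (Equivalence.from T-≡ eq)) y≤x)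

  avoidsᵇ⇒Avoids132 : ∀ {π} → T (avoidsᵇ π p1-3-2) → Avoids132 π
  avoidsᵇ⇒Avoids132 {π} av {a} {c} {b} sub a<b b<c with ⊆-lift 1 π sub
  ... | occ@((_ , a) ∷ (_ , c) ∷ (_ , b) ∷ []) , sub′ , refl = subst T (Equivalence.to T-not-≡ av) (Anyₚ.any⁺ _
    (lose (subst (λ xs → occ ∈ subs 3 xs) (sym (indexed≡indexedFrom π)) (∈-subs⁺ sub′)) ok))
    where
    ok : T (orderIsoᵇ ((1 , a) ∷ (3 , c) ∷ (2 , b) ∷ []))
    -- `orderIsoᵇ` runs through all nine ordered pairs; each rewrite evaluates one comparison of
    -- values.
    ok rewrite ≤⇒<ᵇ-false (≤-refl {a}) | <⇒<ᵇ-true (<-trans a<b b<c) | <⇒<ᵇ-true a<b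
             | ≤⇒<ᵇ-false (<⇒≤ (<-trans a<b b<c)) | ≤⇒<ᵇ-false (≤-refl {c}) | ≤⇒<ᵇ-false (<⇒≤ b<c)
             | ≤⇒<ᵇ-false (<⇒≤ a<b) | <⇒<ᵇ-true b<c | ≤⇒<ᵇ-false (≤-refl {b}) = tt

  Avoids132⇒avoidsᵇ : ∀ {π} → Avoids132 π → T (avoidsᵇ π p1-3-2)
  Avoids132⇒avoidsᵇ {π} av with containsᵇ π p1-3-2 in eq
  ... | false = tt
  ... | true with find (Anyₚ.any⁻ _ (subs 3 (indexed π)) (Equivalence.from T-≡ eq))
  ...   | occ , occ∈ , ok with ∈-subs⁻ 3 (indexed π) occ∈
  ...     | sub , len = impossible occ sub len ok
    where
    impossible : ∀ occ → occ ⊆ indexed π → length occ ≡ 3 →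
                 T (adjOK (false ∷ false ∷ []) occ ∧ orderIsoᵇ (Data.List.zip (1 ∷ 3 ∷ 2 ∷ []) (map proj₂ occ))) → T false
    impossible ((_ , a) ∷ (_ , c) ∷ (_ , b) ∷ []) sub refl ok = av
      (subst (_ ⊆_) (trans (cong (map proj₂) (indexed≡indexedFrom π)) (map-proj₂-indexedFrom 1 π)) (Subₚ.map⁺ proj₂ sub))
      (proj₁ (iso (here refl) (there (there (here refl)))) (s≤s (s≤s z≤n)))
      (proj₁ (iso (there (there (here refl))) (there (here refl))) (s≤s (s≤s (s≤s z≤n))))
      where
      iso = orderIsoᵇ⇒OrderIso ((1 , a) ∷ (3 , c) ∷ (2 , b) ∷ []) ok

  toWord-unique : ∀ t s → Unique (toWord t s)
  toWord-unique leaf       s = []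
  toWord-unique (node l r) s = Uniqueₚ.++⁺ (toWord-unique l (s + size r)) (All.map >⇒≢ right<m ∷ toWord-unique r s) disjoint
    where
    open Node l r s
    disjoint : ∀ {x} → ¬ (x ∈ left × x ∈ m ∷ right)
    disjoint (x∈left , here refl)  = <-irrefl refl (All.lookup left<m x∈left)
    disjoint (x∈left , there x∈right)  = <⇒≱ (proj₁ (All.lookup (toWord-bounds l (s + size r)) x∈left)) (All.lookup right≤ x∈right)

  -- The cases count how many of a, c, b lie in L. If a does, then b > a is not in R, and b is not
  -- the maximum because c > b; so all three lie in L. If none does, a is not the maximum because b
  -- > a, and all three lie in R.
  toWord-Avoids132 : ∀ t s → Avoids132 (toWord t s)
  toWord-Avoids132 leaf       s ()
  toWord-Avoids132 (node l r) s sub a<b b<c with ⊆-++-split (toWord l (s + size r)) sub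
  ... | []                  , _ , refl , _  , _ ∷ʳ q   = toWord-Avoids132 r s q a<b b<c
  ... | []                  , _ , refl , _  , refl ∷ q = <-asym a<b (All.lookup right<m (Subₚ.Any-resp-⊆ q (there (here refl))))
    where open Node l r s
  ... | _ ∷ []              , _ , refl , p  , q        = <⇒≱ (<-trans (proj₁ (All.lookup (toWord-bounds l (s + size r)) (to∈ p))) a<b) (All.lookup right≤ (b∈right q))
    where
    open Node l r s
    b∈right : ∀ {c b} → c ∷ b ∷ [] ⊆ m ∷ right → b ∈ right
    b∈right (_ ∷ʳ q)   = Subₚ.Any-resp-⊆ q (there (here refl))
    b∈right (refl ∷ q) = to∈ q
  ... | _ ∷ _ ∷ []          , _ , refl , p  , _ ∷ʳ q   = <⇒≱ (<-trans (proj₁ (All.lookup (toWord-bounds l (s + size r)) (to∈ p))) a<b) (All.lookup right≤ (to∈ q))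
    where open Node l r s
  ... | _ ∷ _ ∷ []          , _ , refl , p  , refl ∷ q = <-asym b<c (All.lookup left<m (Subₚ.Any-resp-⊆ p (there (here refl))))
    where open Node l r s
  ... | _ ∷ _ ∷ _ ∷ []      , _ , refl , p  , _        = toWord-Avoids132 l (s + size r) p a<b b<c

  length-toWord : ∀ t s → length (toWord t s) ≡ size t
  length-toWord leaf       s = refl
  length-toWord (node l r) s = trans (length-++ (toWord l (s + size r)))
    (trans (cong₂ (λ x y → x + suc y) (length-toWord l (s + size r)) (length-toWord r s)) (+-suc (size l) (size r)))

  -- Equal words have equal length, hence the same maximum at the root. All other letters are
  -- smaller, so both words are cut at the same place.
  toWord-injective : ∀ t t′ s → toWord t s ≡ toWord t′ s → t ≡ t′
  toWord-injective leaf       leaf         s eq = refl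
  toWord-injective leaf       (node l′ r′) s eq with () ← trans (cong length eq) (length-toWord (node l′ r′) s)
  toWord-injective (node l r) leaf         s eq with () ← trans (sym (length-toWord (node l r) s)) (cong length eq)
  toWord-injective (node l r) (node l′ r′) s eq = conclude (split (++-split N.left N′.left eq))
    where
    module N  = Node l r s
    module N′ = Node l′ r′ s
    m≡m′ : N.m ≡ N′.m
    m≡m′ = cong (λ n → suc (s + n)) (suc-injective (trans (sym (length-toWord (node l r) s))
                                                   (trans (cong length eq) (length-toWord (node l′ r′) s))))
    split : _ → N.left ≡ N′.left × N.right ≡ N′.right
    split (inj₁ (δ , e , _))       = ⊥-elim (<-irrefl (sym m≡m′) (All-middle N′.left (subst (All (_< N.m)) e N.left<m)))
    split (inj₂ ([] , e , e′))     = sym (trans e (++-identityʳ N.left)) , proj₂ (∷-injective e′)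
    split (inj₂ (_ ∷ δ , e , e′))  = ⊥-elim (<-irrefl (trans (sym (proj₁ (∷-injective e′))) m≡m′)
                                       (All-middle N.left (subst (All (_< N′.m)) e N′.left<m)))
    conclude : N.left ≡ N′.left × N.right ≡ N′.right → node l r ≡ node l′ r′
    conclude (e₁ , e₂) = cong₂ node
      (toWord-injective l l′ (s + size r) (trans e₁ (cong (λ k → toWord l′ (s + k)) (sym size-r))))
      (toWord-injective r r′ s e₂)
      where
      size-r : size r ≡ size r′
      size-r = trans (sym (length-toWord r s)) (trans (cong length e₂) (length-toWord r′ s))

  module AtMax {s n : ℕ} (α β : List ℕ) (len : length (α ++ s + suc n ∷ β) ≡ suc n) (u : Unique (α ++ s + suc n ∷ β))
               (bs : All (Within s (s + suc n)) (α ++ s + suc n ∷ β)) (av : Avoids132 (α ++ s + suc n ∷ β)) where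

    α⊆ : α ⊆ α ++ s + suc n ∷ β
    α⊆ = Subₚ.++⁺ʳ _ ⊆-refl

    β⊆ : β ⊆ α ++ s + suc n ∷ β
    β⊆ = Subₚ.++⁺ˡ α (_ ∷ʳ ⊆-refl)

    sum-lengths : length α + length β ≡ n
    sum-lengths = suc-injective (trans (sym (length-++-∷ α)) len)

    α-below : All (Within s (s + n)) α
    α-below = Allₚ.++⁻ˡ α (below-max α u bs)

    β-below : All (Within s (s + n)) β
    β-below = Allₚ.++⁻ʳ α (below-max α u bs)

    β<α : ∀ {a b} → a ∈ α → b ∈ β → b < a
    β<α {a} {b} a∈ b∈ = ≤∧≢⇒< (≮⇒≥ a≮b) b≢a
      where
      a≮b : ¬ (a < b)
      -- Otherwise a, the maximum and b would form an occurrence of 132.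
      a≮b a<b = av (Subₚ.++⁺ (from∈ a∈) (refl ∷ from∈ b∈)) a<b
        (≤-<-trans (proj₂ (All.lookup β-below b∈)) (≤-reflexive (sym (+-suc s n))))
      b≢a : b ≢ a
      b≢a b≡a with (a≢b ∷ _) ∷ _ ← Unique-resp-⊆ (Subₚ.++⁺ (from∈ a∈) (_ ∷ʳ from∈ b∈)) u = a≢b (sym b≡a)

    α-within : All (Within (s + length β) (s + length β + length α)) α
    α-within = All.tabulate λ {a} a∈ → let lo , hi = All.lookup α-below a∈ in
      lower a∈ lo , ≤-trans hi (≤-reflexive (trans (cong (s +_) (trans (sym sum-lengths) (+-comm (length α) (length β)))) (sym (+-assoc s _ _))))
      where
      lower : ∀ {a} → a ∈ α → s < a → s + length β < a
      -- The letters of β are distinct values above s and below a.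
      lower a∈ (s≤s s≤a′) = s≤s (unique-length-∸ s≤a′ (Unique-resp-⊆ β⊆ u)
        (All.tabulate λ b∈ → proj₁ (All.lookup β-below b∈) , ≤-pred (β<α a∈ b∈)))

    β-within : All (Within s (s + length β)) β
    β-within = All.tabulate λ {b} b∈ → let lo , hi = All.lookup β-below b∈ in
      -- Dually, the letters of α are distinct values above b and at most s + n, where n is the sum
      -- of the two lengths.
      lo , +-cancelʳ-≤ (length α) b (s + length β) (≤-trans
        (unique-length-∸ hi (Unique-resp-⊆ α⊆ u) (All.tabulate λ a∈ → β<α a∈ b∈ , proj₂ (All.lookup α-below a∈)))
        (≤-reflexive (trans (cong (s +_) (trans (sym sum-lengths) (+-comm (length α) (length β)))) (sym (+-assoc s _ _)))))

  -- Cut at the maximum s + n: letters before it exceed those after it, and counting distinct letters in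
  -- intervals then shows that both sides fill intervals.
  toWord-surjective : ∀ n s π → length π ≡ n → Unique π → All (Within s (s + n)) π → Avoids132 π →
                      ∃ λ t → size t ≡ n × toWord t s ≡ π
  toWord-surjective n s π = go n ≤-refl s π
    where
    -- The bound `d` drives the recursion, since α and β are not structural parts of π.
    go : ∀ d {n} → n ≤ d → ∀ s π → length π ≡ n → Unique π → All (Within s (s + n)) π → Avoids132 π →
         ∃ λ t → size t ≡ n × toWord t s ≡ π
    go d       {zero}  _         s []       len u bs av = leaf , refl , refl
    go (suc d) {suc n} (s≤s n≤d) s π        len u bs av with s + suc n ∈? π
    ... | no  m∉π = ⊥-elim (<-irrefl refl (subst (_≤ n) len (unique-length n u (without-max m∉π bs))))
    ... | yes m∈π with ∈-∃++ m∈π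
    ...   | α , β , refl =
      let open AtMax {s} {n} α β len u bs av
          l , size-l , left-word = go d (≤-trans (subst (length α ≤_) sum-lengths (m≤m+n _ _)) n≤d) (s + length β) α refl
                                   (Unique-resp-⊆ α⊆ u) α-within (Avoids132-resp-⊆ α⊆ av)
          r , size-r , right-word = go d (≤-trans (subst (length β ≤_) sum-lengths (m≤n+m _ _)) n≤d) s β refl
                                   (Unique-resp-⊆ β⊆ u) β-within (Avoids132-resp-⊆ β⊆ av)
          size-l+r = trans (cong₂ _+_ size-l size-r) sum-lengths
      in node l r , cong suc size-l+r ,
         cong₂ _++_ (trans (cong (λ k → toWord l (s + k)) size-r) left-word)
                    (cong₂ _∷_ (trans (sym (+-suc s _)) (cong (λ k → s + suc k) size-l+r)) right-word)

  ∈-concatBelow⁻ : ∀ n {g : ℕ → List A} {x} → x ∈ concatBelow n g → ∃ λ i → i < n × x ∈ g i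
  ∈-concatBelow⁻ (suc n) {g} x∈ with ∈-++⁻ (concatBelow n g) x∈
  ... | inj₁ x∈′ = let i , i<n , x∈g = ∈-concatBelow⁻ n x∈′ in i , m<n⇒m<1+n i<n , x∈g
  ... | inj₂ x∈g = n , ≤-refl , x∈g

  ∈-concatBelow⁺ : ∀ n {g : ℕ → List A} {i x} → i < n → x ∈ g i → x ∈ concatBelow n g
  ∈-concatBelow⁺ (suc n) {g} {i} i<1+n x∈ with i ≟ n
  ... | yes refl = ∈-++⁺ʳ (concatBelow n g) x∈
  ... | no  i≢n  = ∈-++⁺ˡ (∈-concatBelow⁺ n (≤∧≢⇒< (≤-pred i<1+n) i≢n) x∈)

  concatBelow-unique : ∀ n {g : ℕ → List A} → (∀ i → Unique (g i)) → (∀ {i j x} → x ∈ g i → x ∈ g j → i ≡ j) → Unique (concatBelow n g)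
  concatBelow-unique zero    ug disjoint = []
  concatBelow-unique (suc n) ug disjoint = Uniqueₚ.++⁺ (concatBelow-unique n ug disjoint) (ug n)
    λ { (x∈ , x∈gn) → let i , i<n , x∈gi = ∈-concatBelow⁻ n x∈ in <-irrefl (disjoint x∈gi x∈gn) i<n }

  ∈-treesOfHeight⁻ : ∀ d n {t} → t ∈ treesOfHeight d n → size t ≡ n
  ∈-treesOfHeight⁻ zero    zero    (here refl) = refl
  ∈-treesOfHeight⁻ (suc d) zero    (here refl) = refl
  ∈-treesOfHeight⁻ (suc d) (suc n) t∈ with ∈-concatBelow⁻ (suc n) t∈
  ... | i , s≤s i≤n , t∈′ with ∈-cartesianProductWith⁻ node (treesOfHeight d i) (treesOfHeight d (n ∸ i)) t∈′
  ...   | l , r , l∈ , r∈ , refl = cong suc (trans (cong₂ _+_ (∈-treesOfHeight⁻ d i l∈) (∈-treesOfHeight⁻ d (n ∸ i) r∈)) (m+[n∸m]≡n i≤n))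

  ∈-treesOfHeight⁺ : ∀ d t → size t ≤ d → t ∈ treesOfHeight d (size t)
  ∈-treesOfHeight⁺ zero    leaf       _         = here refl
  ∈-treesOfHeight⁺ (suc d) leaf       _         = here refl
  ∈-treesOfHeight⁺ (suc d) (node l r) (s≤s n≤d) = ∈-concatBelow⁺ (suc (size l + size r)) (s≤s (m≤m+n (size l) (size r)))
    (∈-cartesianProductWith⁺ node (∈-treesOfHeight⁺ d l (≤-trans (m≤m+n (size l) (size r)) n≤d))
      (subst (λ k → r ∈ treesOfHeight d k) (sym (m+n∸m≡n (size l) (size r))) (∈-treesOfHeight⁺ d r (≤-trans (m≤n+m (size r) (size l)) n≤d))))

  treesOfHeight-unique : ∀ d n → Unique (treesOfHeight d n)
  treesOfHeight-unique zero    zero    = [] ∷ []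
  treesOfHeight-unique (suc d) zero    = [] ∷ []
  treesOfHeight-unique zero    (suc n) = []
  treesOfHeight-unique (suc d) (suc n) = concatBelow-unique (suc n)
    (λ i → Uniqueₚ.cartesianProductWith⁺ node (λ { refl → refl , refl }) (treesOfHeight-unique d i) (treesOfHeight-unique d (n ∸ i)))
    (λ {i} {j} t∈ t∈′ → same-left {i} {j} (∈-cartesianProductWith⁻ node (treesOfHeight d i) _ t∈) (∈-cartesianProductWith⁻ node (treesOfHeight d j) _ t∈′))
    where
    -- The size of the left subtree determines the block in which a tree is listed.
    same-left : ∀ {i j t} {rs rs′ : List Tree} → (∃ λ l → ∃ λ r → l ∈ treesOfHeight d i × r ∈ rs × t ≡ node l r) →
                (∃ λ l → ∃ λ r → l ∈ treesOfHeight d j × r ∈ rs′ × t ≡ node l r) → i ≡ j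
    same-left (_ , _ , l∈ , _ , refl) (_ , _ , l∈′ , _ , refl) = trans (sym (∈-treesOfHeight⁻ d _ l∈)) (∈-treesOfHeight⁻ d _ l∈′)

  ∈-words⁻ : ∀ n m {π} → π ∈ words n m → length π ≡ n × All (Within 0 m) π
  ∈-words⁻ zero    m (here refl) = refl , []
  ∈-words⁻ (suc n) m π∈ with find (∈-concatMap⁻ (λ a → map (a ∷_) (words n m)) {xs = map suc (upTo m)} π∈)
  ... | a , a∈ , π∈′ with ∈-map⁻ suc a∈ | ∈-map⁻ (a ∷_) π∈′
  ...   | i , i∈ , refl | ρ , ρ∈ , refl = let len , bs = ∈-words⁻ n m ρ∈ in cong suc len , (s≤s z≤n , ∈-upTo⁻ i∈) ∷ bs

  ∈-words⁺ : ∀ {m} π → All (Within 0 m) π → π ∈ words (length π) m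
  ∈-words⁺ []          []                  = here refl
  ∈-words⁺ (suc a ∷ π) ((_ , a<m) ∷ bs)    = ∈-concatMap⁺ _ (lose (∈-map⁺ suc (∈-upTo⁺ a<m)) (∈-map⁺ (suc a ∷_) (∈-words⁺ π bs)))

  concatMap-map : ∀ (h : A → B → C) xs ys → concatMap (λ x → map (h x) ys) xs ≡ cartesianProductWith h xs ys
  concatMap-map h []       ys = refl
  concatMap-map h (x ∷ xs) ys = cong (map (h x) ys ++_) (concatMap-map h xs ys)

  words-unique : ∀ n m → Unique (words n m)
  words-unique zero    m = [] ∷ []
  words-unique (suc n) m = subst Unique (sym (concatMap-map _∷_ (map suc (upTo m)) (words n m)))
    (Uniqueₚ.cartesianProductWith⁺ _∷_ ∷-injective (Uniqueₚ.map⁺ suc-injective (Uniqueₚ.upTo⁺ m)) (words-unique n m))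

  memberᵇ⇒∈ : ∀ a bs → T (memberᵇ a bs) → a ∈ bs
  memberᵇ⇒∈ a (b ∷ bs) ok with Equivalence.to T-∨ ok
  ... | inj₁ a≡b = here (≡ᵇ⇒≡ a b a≡b)
  ... | inj₂ ok′ = there (memberᵇ⇒∈ a bs ok′)

  ∈⇒memberᵇ : ∀ {a bs} → a ∈ bs → T (memberᵇ a bs)
  ∈⇒memberᵇ {a} (here refl) = Equivalence.from T-∨ (inj₁ (≡⇒≡ᵇ a a refl))
  ∈⇒memberᵇ {a} {b ∷ bs} (there a∈) = Equivalence.from (T-∨ {a ≡ᵇ b}) (inj₂ (∈⇒memberᵇ a∈))

  distinctᵇ⇒Unique : ∀ π → T (distinctᵇ π) → Unique π
  distinctᵇ⇒Unique []      _  = []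
  distinctᵇ⇒Unique (a ∷ π) ok with Equivalence.to T-∧ ok
  ... | a∉ , ok′ = All.tabulate (λ { x∈ refl → subst T (Equivalence.to T-not-≡ a∉) (∈⇒memberᵇ x∈) }) ∷ distinctᵇ⇒Unique π ok′

  Unique⇒distinctᵇ : ∀ {π} → Unique π → T (distinctᵇ π)
  Unique⇒distinctᵇ []                = tt
  Unique⇒distinctᵇ {a ∷ π} (a∉ ∷ u)  = Equivalence.from T-∧ (not-member , Unique⇒distinctᵇ u)
    where
    not-member : T (not (memberᵇ a π))
    not-member with memberᵇ a π in eq
    ... | false = tt
    ... | true  = All.lookup a∉ (memberᵇ⇒∈ a π (Equivalence.from T-≡ eq)) refl

  S₁₃₂ : ℕ → List (List ℕ)
  S₁₃₂ n = filterᵇ (λ π → avoidsᵇ π p1-3-2) (S n)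

  -- Duplicate-free lists with the same members are rearrangements of each other, so the two orders
  -- of enumeration need not be related.
  S₁₃₂↭trees : ∀ n → S₁₃₂ n ↭ map (λ t → toWord t 0) (trees n)
  S₁₃₂↭trees n = ∼bag⇒↭ (unique∧set⇒bag
    (Uniqueₚ.filter⁺ (T? ∘ (λ π → avoidsᵇ π p1-3-2)) (Uniqueₚ.filter⁺ (T? ∘ distinctᵇ) (words-unique n n)))
    (Uniqueₚ.map⁺ (λ {t} {t′} → toWord-injective t t′ 0) (treesOfHeight-unique n n))
    (mk⇔ to from))
    where
    to : ∀ {π} → π ∈ S₁₃₂ n → π ∈ map (λ t → toWord t 0) (trees n)
    to {π} π∈ with ∈-filter⁻ (T? ∘ (λ π → avoidsᵇ π p1-3-2)) {xs = S n} π∈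
    ... | π∈S , av with ∈-filter⁻ (T? ∘ distinctᵇ) {xs = words n n} π∈S
    ...   | π∈words , distinct with ∈-words⁻ n n π∈words
    ...     | len , bs with toWord-surjective n 0 π len (distinctᵇ⇒Unique π distinct) bs (avoidsᵇ⇒Avoids132 av)
    ...       | t , refl , refl = ∈-map⁺ (λ t → toWord t 0) (∈-treesOfHeight⁺ n t ≤-refl)
    from : ∀ {π} → π ∈ map (λ t → toWord t 0) (trees n) → π ∈ S₁₃₂ n
    from π∈ with ∈-map⁻ (λ t → toWord t 0) π∈
    ... | t , t∈ , refl with ∈-treesOfHeight⁻ n n t∈
    ...   | refl = ∈-filter⁺ (T? ∘ (λ π → avoidsᵇ π p1-3-2))
      (∈-filter⁺ (T? ∘ distinctᵇ)
        (subst (λ k → toWord t 0 ∈ words k (size t)) (length-toWord t 0) (∈-words⁺ (toWord t 0) (toWord-bounds t 0)))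
        (Unique⇒distinctᵇ (toWord-unique t 0)))
      (Avoids132⇒avoidsᵇ (toWord-Avoids132 t 0))

  filterᵇ-∧ : ∀ (p q : A → Bool) xs → filterᵇ (λ x → p x ∧ q x) xs ≡ filterᵇ q (filterᵇ p xs)
  filterᵇ-∧ p q []       = refl
  filterᵇ-∧ p q (x ∷ xs) with p x
  ... | false = filterᵇ-∧ p q xs
  ... | true with q x
  ...   | true  = cong (x ∷_) (filterᵇ-∧ p q xs)
  ...   | false = filterᵇ-∧ p q xs

  f≡count : ∀ {τ bs} → flags τ ≡ false ∷ bs → ∀ n → f (gpat (letters τ) bs) n ≡ count (avoids τ) (trees n)
  f≡count {τ} {bs} flags-τ n = begin
    f pat n                                                   ≡⟨ cong length (filterᵇ-∧ (λ π → avoidsᵇ π p1-3-2) (λ π → avoidsᵇ π pat) (S n)) ⟩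
    count (λ π → avoidsᵇ π pat) (S₁₃₂ n)                      ≡⟨ ↭-length (filter-↭ (T? ∘ (λ π → avoidsᵇ π pat)) (S₁₃₂↭trees n)) ⟩
    count (λ π → avoidsᵇ π pat) (map (λ t → toWord t 0) (trees n)) ≡⟨ count-map (λ π → avoidsᵇ π pat) (λ t → toWord t 0) (trees n) ⟩
    count (λ t → avoidsᵇ (toWord t 0) pat) (trees n)          ≡⟨ count-cong (avoidsᵇ-toWord {τ} flags-τ) (trees n) ⟩
    count (avoids τ) (trees n)                                ∎
    where
    open ≡-Reasoning
    pat = gpat (letters τ) bs

-- The four families of patterns

open PowerSeries
open Trees
open Containment
open Permutations
open import Data.Bool using (Bool; true; false)
open import Data.Nat using (ℕ; zero; suc; _≤_; z≤n; s≤s) renaming (_+_ to _+ⁿ_)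
import Data.Nat.Properties as ℕₚ
import Data.Rational.Properties as ℚₚ
import Data.Rational as ℚ
open import Data.List using (List; []; _∷_; _++_; length; map; replicate; upTo)
open import Data.List.Properties using (length-map; length-upTo; length-++; map-++; ++-assoc; upTo-∷ʳ)
open import Algebra.Bundles using (CommutativeRing)
open import Data.Product using (_×_; _,_)
open import Relation.Binary.PropositionalEquality
open CommutativeRing commutativeRing using (+-cong; +-congˡ; *-congˡ; *-congʳ; *-identityˡ; *-identityʳ; zeroˡ; zeroʳ; +-identityʳ)
  renaming (refl to ≗-refl; sym to ≗-sym; trans to ≗-trans)
open ≡-Reasoning

_⊕1×_ : Shape → ℕ → Shape
τ ⊕1× zero  = τ
τ ⊕1× suc m = (τ ⊕1× m) ⊕1

-- series (avoids τ) = R (p + 1), cross-multiplied.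
HasSeriesR : ℕ → Shape → Set
HasSeriesR p τ = (series (avoids τ) ⊛ V (suc p)) ≗ V p

HasSeriesR-⊕1 : ∀ {p τ} → HasSeriesR p τ → HasSeriesR (suc p) (τ ⊕1)
HasSeriesR-⊕1 {p} {τ} h = V-step p (series (avoids τ)) (series (avoids (τ ⊕1))) h (series-⊕1 τ)

HasSeriesR-⊕1× : ∀ {p τ} m → HasSeriesR p τ → HasSeriesR (m +ⁿ p) (τ ⊕1× m)
HasSeriesR-⊕1×         zero    h = h
HasSeriesR-⊕1× {p} {τ} (suc m) h = HasSeriesR-⊕1 {m +ⁿ p} {τ ⊕1× m} (HasSeriesR-⊕1× m h)

HasSeriesR-1 : HasSeriesR 0 (ε ⊕1)
HasSeriesR-1 = ≗-trans (*-congʳ {x = onePS} series≗1) (*-identityˡ onePS)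
  where
  F = series (avoids (ε ⊕1))
  series≗1 : F ≗ onePS
  series≗1 = ≗-trans (series-⊕1 ε) (≗-trans (+-congˡ {x = onePS} (≗-trans
    (*-congˡ {x = X} (≗-trans (*-congʳ {x = F} series-false) (zeroˡ F))) (zeroʳ X))) (+-identityʳ onePS))

-- For 12, 21 and 2-1 the series is 1/(1 - x), which `V-step` obtains from R_1 = 1.
HasSeriesR-2 : ∀ τ → series (avoids τ) ≗ (onePS ⊕ (X ⊛ (onePS ⊛ series (avoids τ)))) → HasSeriesR 1 τ
HasSeriesR-2 τ = V-step 0 onePS (series (avoids τ)) (*-identityˡ onePS)

HasSeriesR-21 : ∀ b → HasSeriesR 1 (desc b)
HasSeriesR-21 b = HasSeriesR-2 (desc b) (series-desc b)

-- The empty pattern has series 0, and for r = 0 the quadratic equation degenerates to F = 1 + xF.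
HasSeriesR-12 : HasSeriesR 1 (ε ⊕12)
HasSeriesR-12 = HasSeriesR-2 (ε ⊕12) (≗-trans (series-⊕12 ε) (≗-trans
  (+-cong (+-congˡ {x = onePS} (*-congˡ {x = X} (≗-sym (*-identityˡ F))))
          (≗-trans (*-congˡ {x = X} (≗-trans (*-congˡ {x = X} (≗-trans (*-congʳ {x = F ⊛ F} series-false) (zeroˡ (F ⊛ F)))) (zeroʳ X))) (zeroʳ X)))
  (+-identityʳ (onePS ⊕ (X ⊛ (onePS ⊛ F))))))
  where
  F = series (avoids (ε ⊕12))

series-⊕12≗G : ∀ p τ → HasSeriesR p τ → series (avoids (τ ⊕12)) ≗ G (3 +ⁿ p)
series-⊕12≗G p τ h = quadratic-solution (3 +ⁿ p) F R₀≡1 (≗-trans (series-⊕12 τ)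
  (+-congˡ {x = onePS ⊕ (X ⊛ F)} (*-congˡ {x = X} (*-congˡ {x = X} (*-congʳ {x = F ⊛ F} A≗R)))))
  where
  F = series (avoids (τ ⊕12))
  A = series (avoids τ)
  A≗R : A ≗ R (suc p)
  A≗R = R-unique (suc p) A h
  R₀≡1 : R (suc p) 0 ≡ ℚ.1ℚ
  -- The constant term is read off from the cross-multiplied equation, where both V factors have
  -- constant term 1.
  R₀≡1 = begin
    R (suc p) 0            ≡⟨ A≗R 0 ⟨
    A 0                    ≡⟨ ℚₚ.*-identityʳ (A 0) ⟨
    A 0 ℚ.* ℚ.1ℚ           ≡⟨ cong (A 0 ℚ.*_) (V-zero (suc p)) ⟨
    A 0 ℚ.* V (suc p) 0    ≡⟨ ⊛-zero A (V (suc p)) ⟨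
    (A ⊛ V (suc p)) 0      ≡⟨ h 0 ⟩
    V p 0                  ≡⟨ V-zero p ⟩
    ℚ.1ℚ                   ∎

w12-suc : ∀ k → w12 (suc k) ≡ w12 k ++ suc (length (w12 k)) ∷ []
w12-suc k = begin
  map suc (upTo (suc k))                ≡⟨ cong (map suc) (upTo-∷ʳ k) ⟨
  map suc (upTo k ++ k ∷ [])            ≡⟨ map-++ suc (upTo k) (k ∷ []) ⟩
  w12 k ++ suc k ∷ []                   ≡⟨ cong (λ n → w12 k ++ suc n ∷ []) (trans (length-map suc (upTo k)) (length-upTo k)) ⟨
  w12 k ++ suc (length (w12 k)) ∷ []    ∎

-- Indexed by the number of letters after 21, so that the truncated subtraction in `w21` reduces.
w21⁺ : ℕ → List ℕ
w21⁺ j = w21 (2 +ⁿ j)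

w21⁺-suc : ∀ j → w21⁺ (suc j) ≡ w21⁺ j ++ suc (length (w21⁺ j)) ∷ []
w21⁺-suc j = cong (λ l → 2 ∷ 1 ∷ l) (begin
  map (3 +ⁿ_) (upTo (suc j))                       ≡⟨ cong (map (3 +ⁿ_)) (upTo-∷ʳ j) ⟨
  map (3 +ⁿ_) (upTo j ++ j ∷ [])                   ≡⟨ map-++ (3 +ⁿ_) (upTo j) (j ∷ []) ⟩
  map (3 +ⁿ_) (upTo j) ++ (3 +ⁿ j) ∷ []            ≡⟨ cong (λ n → map (3 +ⁿ_) (upTo j) ++ (3 +ⁿ n) ∷ []) (trans (length-map (3 +ⁿ_) (upTo j)) (length-upTo j)) ⟨
  map (3 +ⁿ_) (upTo j) ++ suc (length (w21⁺ j)) ∷ [] ∎)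

-- Both `w12` and `w21⁺` grow by appending their length plus one, which is the effect of `_⊕1` on
-- letters.
module Letters (w : ℕ → List ℕ) (w-suc : ∀ j → w (suc j) ≡ w j ++ suc (length (w j)) ∷ []) where

  letters-⊕1 : ∀ {τ j} → letters τ ≡ w j → letters (τ ⊕1) ≡ w (suc j)
  letters-⊕1 {j = j} eq rewrite eq = sym (w-suc j)

  letters-⊕12 : ∀ {τ j} → letters τ ≡ w j → letters (τ ⊕12) ≡ w (2 +ⁿ j)
  letters-⊕12 {τ} {j} eq = sym (begin
    w (2 +ⁿ j)
      ≡⟨ w-suc (suc j) ⟩
    w (suc j) ++ suc (length (w (suc j))) ∷ []
      ≡⟨ cong (λ l → l ++ suc (length l) ∷ []) (sym (letters-⊕1 {τ} eq)) ⟩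
    (letters τ ++ suc n ∷ []) ++ suc (length (letters τ ++ suc n ∷ [])) ∷ []
      ≡⟨ ++-assoc (letters τ) _ _ ⟩
    letters τ ++ suc n ∷ suc (length (letters τ ++ suc n ∷ [])) ∷ []
      ≡⟨ cong (λ k → letters τ ++ suc n ∷ suc k ∷ []) (trans (length-++ (letters τ)) (ℕₚ.+-comm n 1)) ⟩
    letters (τ ⊕12) ∎)
    where
    n = length (letters τ)

  letters-⊕1× : ∀ {τ j} m → letters τ ≡ w j → letters (τ ⊕1× m) ≡ w (m +ⁿ j)
  letters-⊕1×     zero    eq = eq
  letters-⊕1× {τ} (suc m) eq = letters-⊕1 {τ ⊕1× m} (letters-⊕1× m eq)

  letters-pattern : ∀ {τ j} m → letters τ ≡ w j → letters ((τ ⊕1× m) ⊕12) ≡ w (2 +ⁿ (m +ⁿ j))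
  letters-pattern {τ} m eq = letters-⊕12 {τ ⊕1× m} (letters-⊕1× m eq)

replicate-++-∷ : ∀ {A : Set} m {x : A} {xs} → replicate m x ++ x ∷ xs ≡ replicate (suc m) x ++ xs
replicate-++-∷ zero    = refl
replicate-++-∷ (suc m) = cong (_ ∷_) (replicate-++-∷ m)

flags-⊕1× : ∀ {τ} m bs → flags (τ ⊕1× m) ++ bs ≡ flags τ ++ replicate m false ++ bs
flags-⊕1×     zero    bs = refl
flags-⊕1× {τ} (suc m) bs = begin
  (flags (τ ⊕1× m) ++ false ∷ []) ++ bs          ≡⟨ ++-assoc (flags (τ ⊕1× m)) _ bs ⟩
  flags (τ ⊕1× m) ++ false ∷ bs                  ≡⟨ flags-⊕1× m (false ∷ bs) ⟩
  flags τ ++ replicate m false ++ false ∷ bs     ≡⟨ cong (flags τ ++_) (replicate-++-∷ m) ⟩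
  flags τ ++ replicate (suc m) false ++ bs       ∎

flags-pattern : ∀ {τ} m → flags ((τ ⊕1× m) ⊕12) ≡ flags τ ++ replicate (suc m) false ++ true ∷ []
flags-pattern {τ} m = trans (flags-⊕1× {τ} m (false ∷ true ∷ [])) (cong (flags τ ++_) (replicate-++-∷ m))

fromℕℚ-f≡G : ∀ p {τ w bs} → HasSeriesR p τ → letters (τ ⊕12) ≡ w → flags (τ ⊕12) ≡ false ∷ bs →
             ∀ n → fromℕℚ (f (gpat w bs) n) ≡ G (3 +ⁿ p) n
fromℕℚ-f≡G p {τ} h refl flags-τ n = trans (cong fromℕℚ (f≡count {τ ⊕12} flags-τ n)) (series-⊕12≗G p τ h n)

module L12 = Letters w12 w12-suc
module L21 = Letters w21⁺ w21⁺-suc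

theorem2p9 : (k : ℕ) → 3 ≤ k →
    ((n : ℕ) → fromℕℚ (f (pat1 k) n) ≡ G k n) ×
    (4 ≤ k →
    ((n : ℕ) → fromℕℚ (f (pat2 k) n) ≡ G k n) ×
    ((n : ℕ) → fromℕℚ (f (pat3 k) n) ≡ G k n) ×
    ((n : ℕ) → fromℕℚ (f (pat4 k) n) ≡ G k n))
theorem2p9 (suc (suc (suc p))) (s≤s (s≤s (s≤s z≤n))) =
  -- Here k = p + 3: the pattern 1 is followed by p dashed letters and the final ascent.
  fromℕℚ-f≡G p {(ε ⊕1) ⊕1× p} (subst (λ q → HasSeriesR q ((ε ⊕1) ⊕1× p)) (ℕₚ.+-identityʳ p) (HasSeriesR-⊕1× {0} {ε ⊕1} p HasSeriesR-1))
    (trans (L12.letters-pattern {ε ⊕1} {1} p refl) (cong (λ q → w12 (2 +ⁿ q)) (ℕₚ.+-comm p 1)))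
    (flags-pattern {ε ⊕1} p) ,
  λ { (s≤s (s≤s (s≤s (s≤s {n = m} z≤n)))) →
    -- Here k = m + 4: the base patterns 12, 2-1 and 21 already have two letters, so only m dashed
    -- letters follow before the ascent.
    fromℕℚ-f≡G (suc m) {(ε ⊕12) ⊕1× m} (hasSeriesR m (ε ⊕12) HasSeriesR-12)
      (trans (L12.letters-pattern {ε ⊕12} {2} m refl) (cong (λ q → w12 (2 +ⁿ q)) (ℕₚ.+-comm m 2)))
      (flags-pattern {ε ⊕12} m) ,
    fromℕℚ-f≡G (suc m) {desc false ⊕1× m} (hasSeriesR m (desc false) (HasSeriesR-21 false))
      (letters-21 m false) (flags-pattern {desc false} m) ,
    fromℕℚ-f≡G (suc m) {desc true ⊕1× m} (hasSeriesR m (desc true) (HasSeriesR-21 true))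
      (letters-21 m true) (flags-pattern {desc true} m) }
  where
  hasSeriesR : ∀ m τ → HasSeriesR 1 τ → HasSeriesR (suc m) (τ ⊕1× m)
  hasSeriesR m τ h = subst (λ q → HasSeriesR q (τ ⊕1× m)) (ℕₚ.+-comm m 1) (HasSeriesR-⊕1× {1} {τ} m h)
  letters-21 : ∀ m b → letters ((desc b ⊕1× m) ⊕12) ≡ w21 (4 +ⁿ m)
  letters-21 m b = trans (L21.letters-pattern {desc b} {0} m refl) (cong (λ q → w21 (4 +ⁿ q)) (ℕₚ.+-identityʳ m))
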